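{- Let $\lambda\ge\kappa$ be infinite cardinals and let $B$ be a boolean algebra with the $(\lambda,\kappa)$-FN. Then the exponential $\exp(B)$ also has the $(\lambda,\kappa)$-FN.
   Context: For infinite cardinals $\lambda\ge\kappa$, a partial order $P$ has the $(\lambda,\kappa)$-FN iff there is a map $(f,g)\colon P\to[P]^{<\lambda}\times[P]^{<\kappa}$ such that for all $p\le q$ in $P$ there exist $r\in f(p)\cap g(q)$ with $p\le r\le q$ and $s\in g(p)\cap f(q)$ with $p\le s\le q$. Here $[P]^{<\mu}$ is the set of subsets of $P$ of cardinality less than $\mu$. A boolean algebra has the $(\lambda,\kappa)$-FN iff its underlying partial order does. For a boolean algebra $B$ with Stone space $\mathrm{Ult}(B)$, the exponential $\exp(B)$ is the algebra of clopen subsets of the Vietoris hyperspace $2^{\mathrm{Ult}(B)}$ of nonempty closed subsets of $\mathrm{Ult}(B)$. Equivalently, $\exp(B)$ is the boolean algebra freely generated by symbols $[a]$ ($a\in B$) modulo the relations $[0]=0$, $[1]=1$, $[a]\le[b]$ whenever $a\le b$, and $[a]\wedge[b]=[a\wedge b]$. -}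

module Defs where

open import Level using (Level; suc)
open import Algebra.Lattice.Bundles using (BooleanAlgebra)
import Algebra.Lattice.Properties.BooleanAlgebra as BooleanAlgebraProperties
open import Data.Nat.Base using (ℕ)
open import Data.Product.Base using (Σ; ∃; _×_; _,_; proj₁; proj₂; swap)
open import Function.Bundles using (Func; Injection; Surjection; _⟨$⟩_)
open import Relation.Binary.Bundles using (Setoid; Poset)
import Relation.Binary.Construct.On as On
open import Relation.Binary.Definitions using (_Respects_)
open import Relation.Binary.PropositionalEquality.Properties using (setoid)
open import Relation.Nullary.Negation.Core using (¬_)
open import Relation.Unary using (Pred; _∈_; _∩_; _≐_)

private
  variable
    ℓ ℓ₁ ℓ₂ : Level

-- Sets are setoids at one level ℓ, and every function and subset below
-- respects the equality of the setoids involved.  In this form "every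
-- surjection has a section" is the axiom of choice of ZFC: unlike the
-- choice principle that is provable in type theory, it demands that the
-- section respect equality.  By Diaconescu's argument it entails
-- Axiom.ExcludedMiddle.ExcludedMiddle ℓ, so assuming it amounts to working
-- in classical mathematics with choice.

AxiomOfChoice : (ℓ : Level) → Set (suc ℓ)
AxiomOfChoice ℓ =
  {A B : Setoid ℓ ℓ} (h : Surjection A B) →
  Σ (Func B A) λ s → ∀ b → Setoid._≈_ B (Surjection.to h (s ⟨$⟩ b)) b

-- A cardinal is given by any set of that cardinality; cardinals are only
-- ever used through _≤ᶜ_ and _<ᶜ_, so the choice of set is immaterial.

Cardinal : (ℓ : Level) → Set (suc ℓ)
Cardinal ℓ = Setoid ℓ ℓ

infix 4 _≤ᶜ_ _<ᶜ_

_≤ᶜ_ : Cardinal ℓ₁ → Cardinal ℓ₂ → Set _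
κ ≤ᶜ μ = Injection κ μ

-- By Cantor–Bernstein, the second component says that the two cardinals
-- are different.

_<ᶜ_ : Cardinal ℓ₁ → Cardinal ℓ₂ → Set _
κ <ᶜ μ = κ ≤ᶜ μ × ¬ (μ ≤ᶜ κ)

Infinite : Cardinal ℓ → Set _
Infinite κ = setoid ℕ ≤ᶜ κ

∣_∣ : {S : Setoid ℓ ℓ} → Pred (Setoid.Carrier S) ℓ → Cardinal ℓ
∣_∣ {S = S} X = On.setoid {B = ∃ X} S proj₁

record SmallSubset (S : Setoid ℓ ℓ) (μ : Cardinal ℓ) : Set (suc ℓ) where
  open Setoid S
  field
    elements : Pred Carrier ℓ
    resp     : elements Respects _≈_
    small    : ∣_∣ {S = S} elements <ᶜ μ

open SmallSubset public

[_]^<_ : Setoid ℓ ℓ → Cardinal ℓ → Setoid (suc ℓ) ℓ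
[ S ]^< μ = record
  { Carrier       = SmallSubset S μ
  ; _≈_           = λ X Y → elements X ≐ elements Y
  ; isEquivalence = record
    { refl  = (λ x → x) , (λ x → x)
    ; sym   = swap
    ; trans = λ (p , q) (p′ , q′) → (λ x → p′ (p x)) , (λ x → q (q′ x))
    }
  }

record FN (Λ κ : Cardinal ℓ) (P : Poset ℓ ℓ ℓ) : Set (suc ℓ) where
  open Poset P
  field
    f : Func Eq.setoid ([ Eq.setoid ]^< Λ)
    g : Func Eq.setoid ([ Eq.setoid ]^< κ)
    interpolate-fg : ∀ {p q} → p ≤ q →
      ∃ λ r → r ∈ elements (f ⟨$⟩ p) ∩ elements (g ⟨$⟩ q) × p ≤ r × r ≤ q
    interpolate-gf : ∀ {p q} → p ≤ q →
      ∃ λ s → s ∈ elements (g ⟨$⟩ p) ∩ elements (f ⟨$⟩ q) × p ≤ s × s ≤ q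

-- The order is the usual one: x ≤ y means x ≈ x ∧ y.

posetOf : BooleanAlgebra ℓ₁ ℓ₂ → Poset ℓ₁ ℓ₂ ℓ₂
posetOf = BooleanAlgebraProperties.poset

-- The boolean algebra presented by generators [ a ] and the relations
-- gen-⊥, gen-⊤, gen-mono, gen-∧: boolean terms over the elements of B, modulo
-- the least congruence containing the axioms of boolean algebras and these
-- relations.  That equal elements give equal generators follows from
-- gen-mono.

module Exponential (B : BooleanAlgebra ℓ₁ ℓ₂) where
  private module B = BooleanAlgebra B
  open Poset (posetOf B) using (_≤_)

  infix  8 ¬′_
  infixr 7 _∧′_
  infixr 6 _∨′_
  infix  4 _∼_

  data Term : Set ℓ₁ where
    [_]       : B.Carrier → Term
    _∨′_ _∧′_ : Term → Term → Term
    ¬′_       : Term → Term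
    ⊤′ ⊥′     : Term

  data _∼_ : Term → Term → Set (ℓ₁ Level.⊔ ℓ₂) where
    ∼-refl  : ∀ {x} → x ∼ x
    ∼-sym   : ∀ {x y} → x ∼ y → y ∼ x
    ∼-trans : ∀ {x y z} → x ∼ y → y ∼ z → x ∼ z

    ∨-cong : ∀ {x x′ y y′} → x ∼ x′ → y ∼ y′ → x ∨′ y ∼ x′ ∨′ y′
    ∧-cong : ∀ {x x′ y y′} → x ∼ x′ → y ∼ y′ → x ∧′ y ∼ x′ ∧′ y′
    ¬-cong : ∀ {x x′} → x ∼ x′ → ¬′ x ∼ ¬′ x′

    ∨-comm        : ∀ x y → x ∨′ y ∼ y ∨′ x
    ∨-assoc       : ∀ x y z → (x ∨′ y) ∨′ z ∼ x ∨′ (y ∨′ z)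
    ∧-comm        : ∀ x y → x ∧′ y ∼ y ∧′ x
    ∧-assoc       : ∀ x y z → (x ∧′ y) ∧′ z ∼ x ∧′ (y ∧′ z)
    ∨-absorbs-∧   : ∀ x y → x ∨′ (x ∧′ y) ∼ x
    ∧-absorbs-∨   : ∀ x y → x ∧′ (x ∨′ y) ∼ x
    ∨-distribˡ-∧  : ∀ x y z → x ∨′ (y ∧′ z) ∼ (x ∨′ y) ∧′ (x ∨′ z)
    ∨-distribʳ-∧  : ∀ x y z → (y ∧′ z) ∨′ x ∼ (y ∨′ x) ∧′ (z ∨′ x)
    ∧-distribˡ-∨  : ∀ x y z → x ∧′ (y ∨′ z) ∼ (x ∧′ y) ∨′ (x ∧′ z)
    ∧-distribʳ-∨  : ∀ x y z → (y ∨′ z) ∧′ x ∼ (y ∧′ x) ∨′ (z ∧′ x)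
    ∨-complementˡ : ∀ x → ¬′ x ∨′ x ∼ ⊤′
    ∨-complementʳ : ∀ x → x ∨′ ¬′ x ∼ ⊤′
    ∧-complementˡ : ∀ x → ¬′ x ∧′ x ∼ ⊥′
    ∧-complementʳ : ∀ x → x ∧′ ¬′ x ∼ ⊥′

    gen-⊥    : [ B.⊥ ] ∼ ⊥′
    gen-⊤    : [ B.⊤ ] ∼ ⊤′
    gen-mono : ∀ {a b} → a ≤ b → [ a ] ∼ [ a ] ∧′ [ b ]
    gen-∧    : ∀ a b → [ a ] ∧′ [ b ] ∼ [ a B.∧ b ]

  exp : BooleanAlgebra ℓ₁ (ℓ₁ Level.⊔ ℓ₂)
  exp = record
    { Carrier = Term
    ; _≈_ = _∼_
    ; _∨_ = _∨′_
    ; _∧_ = _∧′_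
    ; ¬_  = ¬′_
    ; ⊤   = ⊤′
    ; ⊥   = ⊥′
    ; isBooleanAlgebra = record
      { isDistributiveLattice = record
        { isLattice = record
          { isEquivalence = record
            { refl = ∼-refl ; sym = ∼-sym ; trans = ∼-trans }
          ; ∨-comm     = ∨-comm
          ; ∨-assoc    = ∨-assoc
          ; ∨-cong     = ∨-cong
          ; ∧-comm     = ∧-comm
          ; ∧-assoc    = ∧-assoc
          ; ∧-cong     = ∧-cong
          ; absorptive = ∨-absorbs-∧ , ∧-absorbs-∨
          }
        ; ∨-distrib-∧ = ∨-distribˡ-∧ , ∨-distribʳ-∧
        ; ∧-distrib-∨ = ∧-distribˡ-∨ , ∧-distribʳ-∨
        }
      ; ∨-complement = ∨-complementˡ , ∨-complementʳ
      ; ∧-complement = ∧-complementˡ , ∧-complementʳ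
      ; ¬-cong       = ¬-cong
      }
    }

open Exponential public using (exp)

{-# OPTIONS --safe #-}

-- Write the elements of exp B as finite joins of clauses [ a ] ∧ ¬ [ b₁ ] ∧ … ∧ ¬ [ bₙ ].
-- Evaluating at the closed set a ∧ c shows that clauses C = (a , bs) and D = (c , ds) are
-- disjoint iff a ∧ c ≤ 0, a ∧ c ≤ bᵢ for some i, or a ∧ c ≤ dⱼ for some j. Each case is an
-- inequality a ∧ ¬ b ≤ ¬ c ∨ d in B with b = 0 or d = 0, and an interpolant r of it yields
-- [ r ] or ¬ [ ¬ r ] between C and ¬ D. Joins of meets of these elements interpolate x ≤ y.
-- So the map of B extends by sending x, through a chosen normal form, to the sublattice of
-- exp B generated by the [ r ] and ¬ [ ¬ r ] with r in finitely many values of the given map.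
-- That this sublattice is still small rests on μ · μ = μ for infinite cardinals μ, obtained
-- from Zorn's lemma.

module Submission where

open import Defs
open import Level using (Level; Lift; lift; lower; 0ℓ)
open import Algebra.Bundles using (CommutativeSemigroup)
open import Algebra.Lattice.Bundles using (BooleanAlgebra)
import Algebra.Lattice.Properties.BooleanAlgebra as BooleanAlgebraProperties
import Algebra.Properties.CommutativeSemigroup as CommutativeSemigroupProperties
open import Axiom.DoubleNegationElimination using (DoubleNegationElimination; em⇒dne)
open import Axiom.ExcludedMiddle using (ExcludedMiddle)
open import Data.Bool.Base as Bool using (Bool; true; false; T; not; if_then_else_)
import Data.Bool.Properties as Boolₚ
open import Data.Empty using (⊥)
open import Data.Fin.Base using (Fin; toℕ)
open import Data.Fin.Properties using (ℕ→Fin-notInjective; toℕ-injective)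
open import Data.List.Base as List
  using (List; []; _∷_; _++_; map; foldr; concatMap; cartesianProductWith; length; lookup)
open import Data.List.Membership.Propositional using () renaming (_∈_ to _∈ˡ_)
open import Data.List.Membership.Propositional.Properties
  using (∈-map⁺; ∈-map⁻; ∈-++⁺ˡ; ∈-++⁺ʳ; ∈-concatMap⁺)
import Data.List.Membership.Setoid as Membership
import Data.List.Membership.Setoid.Properties as Membershipₚ
open import Data.List.Properties using (map-++)
open import Data.List.Relation.Unary.Any as Any using (here; there; index)
open import Data.List.Relation.Unary.Any.Properties using (lookup-index)
open import Data.Nat.Base using (ℕ; zero; suc; _*_; _<_)
open import Data.Nat.Properties
  using (even≢odd; *-cancelˡ-≡; suc-injective; <-cmp; m<1+n⇒m<n∨m≡n)
open import Data.Product.Base using (∃; ∃₂; _×_; _,_; proj₁; proj₂; swap)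
open import Data.Product.Relation.Binary.Pointwise.NonDependent using (_×ₛ_)
open import Data.Sum.Base using (_⊎_; inj₁; inj₂; [_,_]′)
open import Data.Sum.Function.Setoid using (_⊎-injection_)
open import Data.Sum.Relation.Binary.Pointwise using (_⊎ₛ_; inj₁; inj₂)
open import Function.Base using (id)
open import Function.Bundles using (Func; Injection; Surjection; _⟨$⟩_; mk⇔)
import Function.Construct.Composition as Compose
import Function.Construct.Identity as Identity
open import Relation.Binary.Bundles using (Setoid; Poset)
import Relation.Binary.Construct.On as On
open import Relation.Binary.Definitions using (tri<; tri≈; tri>; _Respects_)
open import Relation.Binary.Lattice using (Lattice)
open import Relation.Binary.PropositionalEquality
  using (_≡_; refl; sym; trans; cong; cong₂; setoid)
open import Relation.Nullary using (Dec; yes; no; does; ¬_; ⌊_⌋; contradiction)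
open import Relation.Nullary.Decidable
  using (toWitness; fromWitness; dec-true; dec-false; does-⇔; _×-dec_)
open import Relation.Unary using (Pred; _∈_; _⊆_; _≐_; _∩_)

-- The set f(x) has to be fixed before any y above x is known, whereas the disjointness of two
-- clauses involves both of them. The shape a ∧ ¬ b ≤ ¬ c ∨ d separates them: its left side is
-- computed from a clause of x alone and its right side from a clause of ¬ y alone, so the two maps
-- given on `B` can be applied side by side. Evaluation at a ∧ c decides disjointness because this
-- is the largest closed set inside both a and c: it satisfies as few of the conditions [ b ] as
-- possible, and if it satisfies some of them, a single b lies above it. Every piece of the
-- interpolant lies in the sublattice for x and in the one for y, and both are closed under the
-- meets and joins that assemble the pieces. Only finitely many small sets are united for each
-- element, so singular cardinals are covered. If the cardinal is ω, small means finite, and it is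
-- distributivity that keeps a finitely generated sublattice finite.

private
  variable
    ℓ a b : Level

-- Choice and Zorn's lemma

≤ᶜ-trans : {X : Cardinal a} {Y : Cardinal b} {Z : Cardinal ℓ} →
  X ≤ᶜ Y → Y ≤ᶜ Z → X ≤ᶜ Z
≤ᶜ-trans = Compose.injection

≤ᶜ-<ᶜ-trans : {X Y Z : Cardinal ℓ} → X ≤ᶜ Y → Y <ᶜ Z → X <ᶜ Z
≤ᶜ-<ᶜ-trans X≤Y (Y≤Z , Z≰Y) = ≤ᶜ-trans X≤Y Y≤Z , λ Z≤X → Z≰Y (≤ᶜ-trans Z≤X X≤Y)

module Choice (ac : AxiomOfChoice ℓ) where

  em : ExcludedMiddle ℓ
  em {P} = decide (s ⟨$⟩ lift true) (s ⟨$⟩ lift false) refl refl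
    where
    -- Diaconescu: under P the points true and false of the quotient coincide.
    quotient : Setoid ℓ ℓ
    quotient = record
      { Carrier = Lift ℓ Bool
      ; _≈_ = λ x y → x ≡ y ⊎ P
      ; isEquivalence = record
        { refl = inj₁ refl
        ; sym = λ { (inj₁ x≡y) → inj₁ (sym x≡y) ; (inj₂ p) → inj₂ p }
        ; trans = λ { (inj₁ refl) q → q ; (inj₂ p) _ → inj₂ p }
        }
      }
    projection : Surjection (setoid (Lift ℓ Bool)) quotient
    projection = record { to = id ; cong = inj₁ ; surjective = λ y → y , inj₁ }

    s : Func quotient (setoid (Lift ℓ Bool))
    s = proj₁ (ac projection)
    decide : ∀ x y → s ⟨$⟩ lift true ≡ x → s ⟨$⟩ lift false ≡ y → Dec P
    decide x y sx sy with proj₂ (ac projection) (lift true) | proj₂ (ac projection) (lift false)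
    ... | inj₂ p | _ = yes p
    ... | inj₁ _ | inj₂ p = yes p
    ... | inj₁ st | inj₁ sf = no λ p →
      contradiction (trans (sym st) (trans (Func.cong s (inj₂ p)) sf)) λ ()

  dne : DoubleNegationElimination ℓ
  dne = em⇒dne em

  ¬∀⇒∃¬ : {A : Set ℓ} {P : Pred A ℓ} → ¬ (∀ x → P x) → ∃ λ x → ¬ P x
  ¬∀⇒∃¬ ¬∀ = dne λ ¬∃ → ¬∀ λ x → dne λ ¬Px → ¬∃ (x , ¬Px)

  -- `R` is a partial surjection from `D` onto `C`, and choice inverts it. Its graph is compared by
  -- the `D`-component only, so a section of the projection to `C` is a map into `D` that respects
  -- equality.
  ≤ᶜ-via : {C D : Setoid ℓ ℓ} (R : Setoid.Carrier D → Setoid.Carrier C → Set ℓ) →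
    (∀ c → ∃ λ d → R d c) →
    (∀ {d d′ c c′} → R d c → R d′ c′ → Setoid._≈_ D d d′ → Setoid._≈_ C c c′) →
    C ≤ᶜ D
  ≤ᶜ-via {C} {D} R total functional = record
    { to = λ c → proj₁ (s ⟨$⟩ c)
    ; cong = Func.cong s
    ; injective = λ {c} {c′} d≈d′ →
        C.trans (C.sym (s-section c)) (C.trans
          (Surjection.cong projection {s ⟨$⟩ c} {s ⟨$⟩ c′} d≈d′) (s-section c′))
    }
    where
    module C = Setoid C
    graph : Setoid ℓ ℓ
    graph = On.setoid {B = ∃ λ d → ∃ λ c → R d c} D proj₁
    projection : Surjection graph C
    projection = record
      { to = λ (_ , c , _) → c
      ; cong = λ { {_ , _ , r} {_ , _ , r′} → functional r r′ }
      ; surjective = λ c → let d , r = total c in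
          (d , c , r) , λ { {_ , _ , r′} → functional r′ r }
      }
    s = proj₁ (ac projection)
    s-section = proj₂ (ac projection)

-- Subsets of Z are encoded by Z → Bool to keep families of subsets at level ℓ, where choice applies.

Subset : Set a → Set a
Subset Z = Z → Bool

⟦_⟧ : {Z : Set a} → Subset Z → Pred Z 0ℓ
⟦ A ⟧ z = T (A z)

infix 4 _⊑_
_⊑_ : {Z : Set a} → Subset Z → Subset Z → Set a
A ⊑ B = ⟦ A ⟧ ⊆ ⟦ B ⟧

Chain : {Z : Set a} → Pred (Subset Z) b → Set _
Chain C = ∀ {A B} → C A → C B → A ⊑ B ⊎ B ⊑ A

IsUnion : {Z : Set a} → Pred (Subset Z) b → Subset Z → Set _
IsUnion C U = (∀ {A} → C A → A ⊑ U) × (∀ {z} → z ∈ ⟦ U ⟧ → ∃ λ A → C A × z ∈ ⟦ A ⟧)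

-- The empty chain is included, so such a family contains the empty subset.
ChainClosed : {Z : Set a} → Pred (Subset Z) a → Set _
ChainClosed {a} {Z} F =
  (C : Pred (Subset Z) a) → C ⊆ F → Chain C → ∀ {U} → IsUnion C U → F U

module Zorn (ac : AxiomOfChoice ℓ) {Z : Set ℓ}
  (F : Pred (Subset Z) ℓ) (F-closed : ChainClosed F) where

  open Choice ac

  comprehension : (P : Pred Z ℓ) → Subset Z
  comprehension P z = ⌊ em {P z} ⌋

  subsets : Setoid ℓ ℓ
  subsets = record
    { Carrier = Subset Z
    ; _≈_ = λ A B → A ⊑ B × B ⊑ A
    ; isEquivalence = record
      { refl = id , id
      ; sym = swap
      ; trans = λ (p , q) (p′ , q′) → (λ x → p′ (p x)) , (λ x → q (q′ x))
      }
    }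

  -- Subsets with the same points need not be propositionally equal. Invariance is an instance of
  -- chain closure: `B` is a union of the chain of all copies of `A` in `F`.
  F-resp : ∀ {A B} → A ⊑ B → B ⊑ A → F A → F B
  F-resp {A} {B} A⊑B B⊑A FA = F-closed C
      (λ (A⊑X , X⊑A , FX) → FX)
      (λ (_ , X⊑A , _) (A⊑Y , _) → inj₁ λ x → A⊑Y (X⊑A x))
      ((λ (_ , X⊑A , _) x → A⊑B (X⊑A x)) , λ z∈B → A , (id , id , FA) , B⊑A z∈B)
    where
    C : Pred (Subset Z) ℓ
    C X = A ⊑ X × X ⊑ A × F X

  Maximal : Pred (Subset Z) ℓ
  Maximal A = F A × (∀ {B} → F B → A ⊑ B → B ⊑ A)

  module NoMaximal (¬max : ¬ ∃ Maximal) where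

    -- The premise `F A` makes every subset have an extension, so that choice can be applied to all
    -- of `subsets`.
    Extends : Subset Z → Subset Z → Set ℓ
    Extends A B = A ⊑ B × (F A → F B × ¬ B ⊑ A)

    extend : ∀ A → ∃ (Extends A)
    extend A with em {F A}
    ... | no ¬FA = A , id , λ FA → contradiction FA ¬FA
    ... | yes FA = dne {P = ∃ (Extends A)} λ ¬ext → ¬max (A , FA , λ {B} FB A⊑B →
      dne {P = B ⊑ A} λ B⋢A → ¬ext (B , A⊑B , λ _ → FB , B⋢A))

    extensions : Setoid ℓ ℓ
    extensions = record
      { Carrier = ∃₂ Extends
      -- Comparing the extensions as well is what later makes `next` respect equality of subsets.
      ; _≈_ = λ (A , B , _) (A′ , B′ , _) → A ≈ A′ × B ≈ B′
      ; isEquivalence = record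
        { refl = ≈-refl , ≈-refl
        ; sym = λ (p , q) → ≈-sym p , ≈-sym q
        ; trans = λ (p , q) (p′ , q′) → ≈-trans p p′ , ≈-trans q q′
        }
      }
      where open Setoid subsets renaming (refl to ≈-refl; sym to ≈-sym; trans to ≈-trans)

    source : Surjection extensions subsets
    source = record
      { to = proj₁
      ; cong = proj₁
      ; surjective = λ A → let B , AB = extend A in (A , B , AB) , proj₁
      }

    choose : Func subsets extensions
    choose = proj₁ (ac source)

    next : Subset Z → Subset Z
    next A = proj₁ (proj₂ (choose ⟨$⟩ A))

    next-cong : ∀ {A B} → A ⊑ B → B ⊑ A → next A ⊑ next B
    next-cong A⊑B B⊑A = proj₁ (proj₂ (Func.cong choose (A⊑B , B⊑A)))

    ⊑-next : ∀ A → A ⊑ next A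
    ⊑-next A x = proj₁ (proj₂ (proj₂ (choose ⟨$⟩ A))) (proj₂ (proj₂ (ac source) A) x)

    next-F : ∀ {A} → F A → F (next A) × ¬ next A ⊑ A
    next-F {A} FA with proj₂ (ac source) A
    ... | A′⊑A , A⊑A′ with proj₂ (proj₂ (proj₂ (choose ⟨$⟩ A))) (F-resp A⊑A′ A′⊑A FA)
    ... | FB , B⋢A′ = FB , λ B⊑A → B⋢A′ λ x → A⊑A′ (B⊑A x)

    data Tower : Pred (Subset Z) ℓ where
      succ : ∀ {A} → Tower A → Tower (next A)
      sup  : ∀ (C : Subset (Subset Z)) {U} → ⟦ C ⟧ ⊆ Tower → IsUnion ⟦ C ⟧ U → Tower U

    -- Plain comparability does not pass to successors; this form, which leaves no gap between `A`
    -- and `next A`, does.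
    Compared : Subset Z → Subset Z → Set ℓ
    Compared A B = next A ⊑ B ⊎ B ⊑ A

    compared-succ : ∀ {A B} → Compared A B → Compared B A → Compared A (next B)
    compared-succ {A} {B} (inj₁ nA⊑B) _ = inj₁ λ x → ⊑-next B (nA⊑B x)
    compared-succ (inj₂ B⊑A) (inj₁ nB⊑A) = inj₂ nB⊑A
    -- Here `A` and `B` have the same points, so their successors agree.
    compared-succ (inj₂ B⊑A) (inj₂ A⊑B) = inj₁ (next-cong A⊑B B⊑A)

    compared-sup : ∀ {A U} (C : Subset (Subset Z)) → IsUnion ⟦ C ⟧ U →
      (∀ {B} → B ∈ ⟦ C ⟧ → Compared A B) → Compared A U
    compared-sup {A} C (C⊑U , U-covered) cmp
      with em {∃ λ B → B ∈ ⟦ C ⟧ × next A ⊑ B}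
    ... | yes (B , B∈C , nA⊑B) = inj₁ λ x → C⊑U B∈C (nA⊑B x)
    ... | no none = inj₂ λ z∈U → let B , B∈C , z∈B = U-covered z∈U in
      [ (λ nA⊑B → contradiction (B , B∈C , nA⊑B) none) , (λ B⊑A → B⊑A z∈B) ]′ (cmp B∈C)

    compared : ∀ {A B} → Tower A → Tower B → Compared A B × Compared B A
    compared (succ {A} tA) tB = lower-upper tB , upper tB
      where
      upper : ∀ {B} → Tower B → Compared B (next A)
      upper tB = let AB , BA = compared tA tB in compared-succ BA AB
      lower-upper : ∀ {B} → Tower B → Compared (next A) B
      lower-upper (succ tB) = compared-succ (lower-upper tB) (upper tB)
      lower-upper (sup C C⊆T isU) = compared-sup C isU λ B∈C → lower-upper (C⊆T B∈C)
    compared {U} (sup C C⊆T isU) tB = lower-upper tB , upper tB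
      where
      upper : ∀ {B} → Tower B → Compared B U
      upper tB = compared-sup C isU λ A∈C → proj₂ (compared (C⊆T A∈C) tB)
      lower-upper : ∀ {B} → Tower B → Compared U B
      lower-upper (succ tB) = compared-succ (lower-upper tB) (upper tB)
      lower-upper (sup D D⊆T isV) = compared-sup D isV λ B∈D → lower-upper (D⊆T B∈D)

    tower-chain : Chain Tower
    tower-chain {A} tA tB with proj₁ (compared tA tB)
    ... | inj₁ nA⊑B = inj₁ λ x → nA⊑B (⊑-next A x)
    ... | inj₂ B⊑A = inj₂ B⊑A

    tower⊆F : Tower ⊆ F
    tower⊆F (succ tA) = proj₁ (next-F (tower⊆F tA))
    tower⊆F (sup C C⊆T isU) = F-closed (λ A → Lift ℓ (A ∈ ⟦ C ⟧))
      (λ A∈C → tower⊆F (C⊆T (lower A∈C)))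
      (λ A∈C B∈C → tower-chain (C⊆T (lower A∈C)) (C⊆T (lower B∈C)))
      ((λ A∈C → proj₁ isU (lower A∈C)) ,
       λ z∈U → let A , A∈C , z∈A = proj₂ isU z∈U in A , lift A∈C , z∈A)

    tower : Subset (Subset Z)
    tower A = ⌊ em {Tower A} ⌋

    top : Subset Z
    top = comprehension λ z → ∃ λ A → Tower A × z ∈ ⟦ A ⟧

    Tower⊑top : ∀ {A} → Tower A → A ⊑ top
    Tower⊑top tA z∈A = fromWitness (_ , tA , z∈A)

    top-Tower : Tower top
    top-Tower = sup tower toWitness
      ( (λ A∈ → Tower⊑top (toWitness A∈))
      , λ z∈ → let A , tA , z∈A = toWitness z∈ in A , fromWitness tA , z∈A )

    -- The union of the tower belongs to the tower, hence so does its successor, which is then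
    -- contained in that union although it extends it properly.
    absurd : ⊥
    absurd = proj₂ (next-F (tower⊆F top-Tower)) (Tower⊑top (succ top-Tower))

  zorn : ∃ Maximal
  zorn = dne NoMaximal.absurd

-- Comparability and squares of cardinals

module Comparability (ac : AxiomOfChoice ℓ) (X Y : Cardinal ℓ) where

  open Choice ac
  private
    module X = Setoid X
    module Y = Setoid Y

  PartialBijection : Pred (Subset (X.Carrier × Y.Carrier)) ℓ
  PartialBijection R = ∀ {x y x′ y′} → (x , y) ∈ ⟦ R ⟧ → (x′ , y′) ∈ ⟦ R ⟧ →
    (x X.≈ x′ → y Y.≈ y′) × (y Y.≈ y′ → x X.≈ x′)

  chain-closed : ChainClosed PartialBijection
  chain-closed C C⊆F chain (_ , covered) r r′ with covered r | covered r′
  ... | A , A∈C , r∈A | B , B∈C , r′∈B with chain A∈C B∈C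
  ... | inj₁ A⊑B = C⊆F B∈C (A⊑B r∈A) r′∈B
  ... | inj₂ B⊑A = C⊆F A∈C r∈A (B⊑A r′∈B)

  open Zorn ac PartialBijection chain-closed

  -- A maximal partial bijection is total on one side; otherwise a free point of `X` could be
  -- matched with a free point of `Y`.
  comparable : X ≤ᶜ Y ⊎ Y ≤ᶜ X
  comparable with zorn
  ... | R , bij , maximal
      with em {∀ x → ∃₂ λ x′ y → x X.≈ x′ × (x′ , y) ∈ ⟦ R ⟧}
         | em {∀ y → ∃₂ λ x y′ → y Y.≈ y′ × (x , y′) ∈ ⟦ R ⟧}
  ... | yes total | _ = inj₁ (record
    { to = λ x → proj₁ (proj₂ (total x))
    ; cong = λ {x} {x′} x≈x′ → proj₁ (bij (inR x) (inR x′))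
        (X.trans (X.sym (near x)) (X.trans x≈x′ (near x′)))
    ; injective = λ {x} {x′} y≈y′ →
        X.trans (near x) (X.trans (proj₂ (bij (inR x) (inR x′)) y≈y′) (X.sym (near x′)))
    })
    where
    near = λ x → proj₁ (proj₂ (proj₂ (total x)))
    inR = λ x → proj₂ (proj₂ (proj₂ (total x)))
  ... | no _ | yes total = inj₂ (record
    { to = λ y → proj₁ (total y)
    ; cong = λ {y} {y′} y≈y′ → proj₂ (bij (inR y) (inR y′))
        (Y.trans (Y.sym (near y)) (Y.trans y≈y′ (near y′)))
    ; injective = λ {y} {y′} x≈x′ →
        Y.trans (near y) (Y.trans (proj₁ (bij (inR y) (inR y′)) x≈x′) (Y.sym (near y′)))
    })
    where
    near = λ y → proj₁ (proj₂ (proj₂ (total y)))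
    inR = λ y → proj₂ (proj₂ (proj₂ (total y)))
  ... | no ¬totalˣ | no ¬totalʸ =
    contradiction (x₀ , y₀ , X.refl ,
      maximal R′-bij (λ r → fromWitness (inj₁ r)) (fromWitness (inj₂ refl))) x₀-free
    where
    x₀ = proj₁ (¬∀⇒∃¬ ¬totalˣ)
    x₀-free = proj₂ (¬∀⇒∃¬ ¬totalˣ)
    y₀ = proj₁ (¬∀⇒∃¬ ¬totalʸ)
    y₀-free = proj₂ (¬∀⇒∃¬ ¬totalʸ)
    R′ : Subset (X.Carrier × Y.Carrier)
    R′ = comprehension λ z → z ∈ ⟦ R ⟧ ⊎ z ≡ (x₀ , y₀)
    R′-bij : PartialBijection R′
    R′-bij r r′ with toWitness r | toWitness r′
    ... | inj₁ r | inj₁ r′ = bij r r′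
    ... | inj₂ refl | inj₂ refl = (λ _ → Y.refl) , (λ _ → X.refl)
    ... | inj₁ r | inj₂ refl =
      (λ x≈x₀ → contradiction (_ , _ , X.sym x≈x₀ , r) x₀-free) ,
      (λ y≈y₀ → contradiction (_ , _ , Y.sym y≈y₀ , r) y₀-free)
    ... | inj₂ refl | inj₁ r =
      (λ x₀≈x → contradiction (_ , _ , x₀≈x , r) x₀-free) ,
      (λ y₀≈y → contradiction (_ , _ , y₀≈y , r) y₀-free)

-- With the factor Bool, Square X ≤ᶜ X also gives X ⊎ X ≤ᶜ X, and provides tags for coding trees.

Square : Cardinal a → Cardinal a
Square X = setoid Bool ×ₛ (X ×ₛ X)

square-map : {X : Cardinal a} {Y : Cardinal b} → X ≤ᶜ Y → Square X ≤ᶜ Square Y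
square-map i = record
  { to = λ (b , x , y) → b , to x , to y
  ; cong = λ (p , q , r) → p , cong′ q , cong′ r
  ; injective = λ (p , q , r) → p , injective q , injective r
  }
  where open Injection i renaming (cong to cong′)

⊎-≤-square : (X : Cardinal a) → (X ⊎ₛ X) ≤ᶜ Square X
⊎-≤-square X = record
  { to = λ { (inj₁ x) → false , x , x ; (inj₂ x) → true , x , x }
  ; cong = λ { (inj₁ p) → refl , p , p ; (inj₂ p) → refl , p , p }
  ; injective = λ { {inj₁ _} {inj₁ _} (_ , p , _) → inj₁ p
                  ; {inj₂ _} {inj₂ _} (_ , p , _) → inj₂ p
                  ; {inj₁ _} {inj₂ _} (() , _) ; {inj₂ _} {inj₁ _} (() , _) }
  }

square-⊎-≤ : {X : Cardinal a} → Square X ≤ᶜ X → Square (X ⊎ₛ X) ≤ᶜ X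
square-⊎-≤ {X = X} s = ≤ᶜ-trans (square-map (≤ᶜ-trans (⊎-≤-square X) s)) s

-- The number 2^m · (2n + 1).
pair : ℕ → ℕ → ℕ
pair zero    n = suc (2 * n)
pair (suc m) n = 2 * pair m n

pair-injective : ∀ m n m′ n′ → pair m n ≡ pair m′ n′ → m ≡ m′ × n ≡ n′
pair-injective zero n zero n′ eq = refl , *-cancelˡ-≡ n n′ 2 (suc-injective eq)
pair-injective zero n (suc m′) n′ eq = contradiction (sym eq) (even≢odd (pair m′ n′) n)
pair-injective (suc m) n zero n′ eq = contradiction eq (even≢odd (pair m n) n′)
pair-injective (suc m) n (suc m′) n′ eq
  with refl , refl ← pair-injective m n m′ n′ (*-cancelˡ-≡ _ _ 2 eq) = refl , refl

square-ℕ : Square (setoid ℕ) ≤ᶜ setoid ℕ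
square-ℕ = record
  { to = encode
  ; cong = λ { (refl , refl , refl) → refl }
  ; injective = λ {x} {y} → injective x y
  }
  where
  encode : Bool × ℕ × ℕ → ℕ
  encode (false , m , n) = 2 * pair m n
  encode (true  , m , n) = suc (2 * pair m n)
  injective : ∀ x y → encode x ≡ encode y → Setoid._≈_ (Square (setoid ℕ)) x y
  injective (false , m , n) (false , m′ , n′) eq =
    refl , pair-injective m n m′ n′ (*-cancelˡ-≡ _ _ 2 eq)
  injective (true , m , n) (true , m′ , n′) eq =
    refl , pair-injective m n m′ n′ (*-cancelˡ-≡ _ _ 2 (suc-injective eq))
  injective (false , m , n) (true , m′ , n′) eq = contradiction eq (even≢odd (pair m n) (pair m′ n′))
  injective (true , m , n) (false , m′ , n′) eq = contradiction (sym eq) (even≢odd (pair m′ n′) (pair m n))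

-- Hessenberg's theorem: infinite cardinals equal their squares

module InfiniteSquare (ac : AxiomOfChoice ℓ) (K : Cardinal ℓ) where

  open Choice ac
  private
    module K = Setoid K
    module SK = Setoid (Square K)

  -- A partial injection of squares together with its domain, packed into one subset of a disjoint
  -- sum: inclusion of subsets is then extension of pairings, and Zorn's lemma applies as stated.
  Pairing : Set ℓ
  Pairing = Subset (K.Carrier ⊎ (SK.Carrier × K.Carrier))

  domain : Pairing → Pred K.Carrier 0ℓ
  domain A k = inj₁ k ∈ ⟦ A ⟧

  graph : Pairing → SK.Carrier → K.Carrier → Set
  graph A t k = inj₂ (t , k) ∈ ⟦ A ⟧

  record IsPairing (A : Pairing) : Set ℓ where
    field
      domain-resp   : ∀ {k k′} → k K.≈ k′ → domain A k → domain A k′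
      bij    : ∀ {t t′ k k′} → graph A t k → graph A t′ k′ →
               (t SK.≈ t′ → k K.≈ k′) × (k K.≈ k′ → t SK.≈ t′)
      total  : ∀ {b x y} → domain A x → domain A y → ∃ λ k → graph A (b , x , y) k
      within : ∀ {b x y k} → graph A (b , x , y) k → (domain A x × domain A y) × domain A k

  chain-closed : ChainClosed IsPairing
  chain-closed C C⊆F chain {U} (C⊑U , covered) = record
    { domain-resp = λ k≈k′ u → let A , A∈C , k∈A = covered u in
        C⊑U A∈C (IsPairing.domain-resp (C⊆F A∈C) k≈k′ k∈A)
    ; bij = λ g g′ → let A , A∈C , g , g′ = both g g′ in IsPairing.bij (C⊆F A∈C) g g′
    ; total = λ u v → let A , A∈C , u , v = both u v
                          k , g = IsPairing.total (C⊆F A∈C) u v in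
        k , C⊑U A∈C g
    ; within = λ g → let A , A∈C , g = covered g
                         (u , v) , w = IsPairing.within (C⊆F A∈C) g in
        (C⊑U A∈C u , C⊑U A∈C v) , C⊑U A∈C w
    }
    where
    both : ∀ {z z′} → z ∈ ⟦ U ⟧ → z′ ∈ ⟦ U ⟧ → ∃ λ A → C A × z ∈ ⟦ A ⟧ × z′ ∈ ⟦ A ⟧
    both u u′ with covered u | covered u′
    ... | A , A∈C , v | B , B∈C , v′ with chain A∈C B∈C
    ... | inj₁ A⊑B = B , B∈C , A⊑B v , v′
    ... | inj₂ B⊑A = A , A∈C , v , B⊑A v′

  open Zorn ac IsPairing chain-closed

  -- The domain of a pairing (true) and its complement (false).

  _on_ : Pairing → Bool → Cardinal ℓ
  A on b = On.setoid {B = ∃ λ k → Lift ℓ (inside b k)} K proj₁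
    where
    inside : Bool → Pred K.Carrier 0ℓ
    inside true k = domain A k
    inside false k = ¬ domain A k

  _on_⊆K : ∀ A b → (A on b) ≤ᶜ K
  A on b ⊆K = record { to = proj₁ ; cong = id ; injective = id }

  on-square : ∀ {A} → IsPairing A → Square (A on true) ≤ᶜ (A on true)
  on-square {A} A-pairing = record
    { to = λ { (b , (x , lift p) , (y , lift q)) →
        let k , g = total p q in k , lift (proj₂ (within g)) }
    ; cong = λ { {_ , (_ , lift p) , (_ , lift q)} {_ , (_ , lift p′) , (_ , lift q′)} →
        proj₁ (bij (proj₂ (total p q)) (proj₂ (total p′ q′))) }
    ; injective = λ { {_ , (_ , lift p) , (_ , lift q)} {_ , (_ , lift p′) , (_ , lift q′)} →
        proj₂ (bij (proj₂ (total p q)) (proj₂ (total p′ q′))) }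
    }
    where open IsPairing A-pairing

  -- The pairs that meet the new points I take their codes in I, so the pairing extends to X ∪ I.

  module Extension {A : Pairing} (A-pairing : IsPairing A)
    {I : Cardinal ℓ} (e : I ≤ᶜ K) (i₀ : Setoid.Carrier I)
    (fresh : ∀ i → ¬ domain A (Injection.to e i))
    (h : Square ((A on true) ⊎ₛ I) ≤ᶜ I) where

    open IsPairing A-pairing
    private
      module e = Injection e
      module h = Injection h
      S = (A on true) ⊎ₛ I
      module S = Setoid S

    incl-to : S.Carrier → K.Carrier
    incl-to (inj₁ (x , _)) = x
    incl-to (inj₂ i)       = e.to i

    incl : S ≤ᶜ K
    incl = record
      { to = incl-to
      ; cong = λ { (inj₁ p) → p ; (inj₂ p) → e.cong p }
      ; injective = λ { {inj₁ _} {inj₁ _} p → inj₁ p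
                      ; {inj₂ _} {inj₂ _} p → inj₂ (e.injective p)
                      ; {inj₁ (_ , lift x)} {inj₂ i} p → contradiction (domain-resp p x) (fresh i)
                      ; {inj₂ i} {inj₁ (_ , lift x)} p → contradiction (domain-resp (K.sym p) x) (fresh i) }
      }
    module incl = Injection incl
    incl² = square-map incl
    module incl² = Injection incl²

    New : SK.Carrier → K.Carrier → Set ℓ
    New t@(_ , x , y) k =
      ¬ (domain A x × domain A y) × ∃ λ u → incl².to u SK.≈ t × e.to (h.to u) K.≈ k

    A′ : Pairing
    A′ = comprehension λ
      { (inj₁ k) → ∃ λ s → incl-to s K.≈ k
      ; (inj₂ (t , k)) → graph A t k ⊎ New t k }

    -- The arguments differ because a new one has a coordinate outside the old domain; the codes
    -- differ because old ones lie in that domain and new ones are fresh.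
    old-new : ∀ {t k t′ k′} → graph A t k → New t′ k′ → ¬ t SK.≈ t′ × ¬ k K.≈ k′
    old-new g (¬over , u , _ , hu≈k′) with within g
    ... | (x , y) , k∈ =
      (λ (_ , p , q) → ¬over (domain-resp p x , domain-resp q y)) ,
      (λ k≈k′ → fresh (h.to u) (domain-resp (K.trans k≈k′ (K.sym hu≈k′)) k∈))

    A′-pairing : IsPairing A′
    A′-pairing = record
      { domain-resp = λ k≈k′ m → let s , p = toWitness m in fromWitness (s , K.trans p k≈k′)
      ; bij = λ g g′ → bij′ (toWitness g) (toWitness g′)
      ; total = λ {b} {x} {y} m m′ → total′ b x y (toWitness m) (toWitness m′)
      ; within = λ g → within′ (toWitness g)
      }
      where
      bij′ : ∀ {t k t′ k′} → graph A t k ⊎ New t k → graph A t′ k′ ⊎ New t′ k′ →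
        (t SK.≈ t′ → k K.≈ k′) × (k K.≈ k′ → t SK.≈ t′)
      bij′ (inj₁ g) (inj₁ g′) = bij g g′
      bij′ (inj₁ g) (inj₂ n) = let p , q = old-new g n in
        (λ t≈ → contradiction t≈ p) , (λ k≈ → contradiction k≈ q)
      bij′ (inj₂ n) (inj₁ g) = let p , q = old-new g n in
        (λ t≈ → contradiction (SK.sym t≈) p) , (λ k≈ → contradiction (K.sym k≈) q)
      bij′ (inj₂ (_ , u , p , q)) (inj₂ (_ , u′ , p′ , q′)) =
        (λ t≈ → K.trans (K.sym q) (K.trans
          (e.cong (h.cong (incl².injective {u} {u′} (SK.trans p (SK.trans t≈ (SK.sym p′)))))) q′)) ,
        (λ k≈ → SK.trans (SK.sym p) (SK.trans
          (incl².cong {u} {u′} (h.injective (e.injective (K.trans q (K.trans k≈ (K.sym q′)))))) p′))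
      total′ : ∀ b x y → (∃ λ s → incl-to s K.≈ x) → (∃ λ s → incl-to s K.≈ y) →
        ∃ λ k → graph A′ (b , x , y) k
      total′ b x y (s , p) (s′ , p′) with em {Lift ℓ (domain A x × domain A y)}
      ... | yes (lift (m , m′)) = let k , g = total m m′ in k , fromWitness (inj₁ g)
      ... | no ¬o = e.to (h.to (b , s , s′)) ,
        fromWitness (inj₂ ((λ o → ¬o (lift o)) , (b , s , s′) , (refl , p , p′) , K.refl))
      within′ : ∀ {b x y k} → graph A (b , x , y) k ⊎ New (b , x , y) k →
        (domain A′ x × domain A′ y) × domain A′ k
      within′ (inj₁ g) = let (x , y) , k = within g in
        (fromWitness (inj₁ (_ , lift x) , K.refl) , fromWitness (inj₁ (_ , lift y) , K.refl)) ,
        fromWitness (inj₁ (_ , lift k) , K.refl)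
      within′ (inj₂ (_ , (_ , s , s′) , (_ , p , p′) , q)) =
        (fromWitness (s , p) , fromWitness (s′ , p′)) , fromWitness (inj₂ _ , q)

    A⊑A′ : A ⊑ A′
    A⊑A′ {inj₁ k} m = fromWitness (inj₁ (k , lift m) , K.refl)
    A⊑A′ {inj₂ _} g = fromWitness (inj₁ g)

    not-maximal : ¬ Maximal A
    not-maximal (_ , maximal) = fresh i₀ (maximal A′-pairing A⊑A′ (fromWitness (inj₂ i₀ , K.refl)))

  -- A pairing with empty domain extends to a copy of ω inside `K`, by `square-ℕ`.
  maximal-nonempty : Infinite K → ∀ {A} → Maximal A → ∃ λ k → Lift ℓ (domain A k)
  maximal-nonempty ω≤K {A} max@(A-pairing , _) = dne λ empty →
    Extension.not-maximal A-pairing {I = ω} (≤ᶜ-trans ω≤ℕ ω≤K) (lift 0)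
      (λ i m → empty (_ , lift m)) (≤ᶜ-trans (square-map (bound empty)) (≤ᶜ-trans square-ℕ ℕ≤ω)) max
    where
    ω : Cardinal ℓ
    ω = setoid (Lift ℓ ℕ)
    ω≤ℕ : ω ≤ᶜ setoid ℕ
    ω≤ℕ = record { to = lower ; cong = cong lower ; injective = cong lift }
    ℕ≤ω : setoid ℕ ≤ᶜ ω
    ℕ≤ω = record { to = lift ; cong = cong lift ; injective = cong lower }
    bound : ¬ (∃ λ k → Lift ℓ (domain A k)) → ((A on true) ⊎ₛ ω) ≤ᶜ setoid ℕ
    bound empty = record
      { to = λ { (inj₁ x) → contradiction x empty ; (inj₂ (lift n)) → n }
      ; cong = λ { {inj₁ x} _ → contradiction x empty ; (inj₂ refl) → refl }
      ; injective = λ { {inj₁ x} _ → contradiction x empty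
                      ; {inj₂ _} {inj₁ x} _ → contradiction x empty
                      ; {inj₂ _} {inj₂ _} refl → inj₂ refl }
      }

  split : ∀ {A} → IsPairing A → K ≤ᶜ ((A on true) ⊎ₛ (A on false))
  split {A} A-pairing = record
    { to = λ k → side k (Boolₚ.T? _)
    ; cong = λ {k} {k′} → side-cong k k′ (Boolₚ.T? _) (Boolₚ.T? _)
    ; injective = λ {k} {k′} → side-injective k k′ (Boolₚ.T? _) (Boolₚ.T? _)
    }
    where
    open IsPairing A-pairing
    open Setoid ((A on true) ⊎ₛ (A on false)) using (Carrier; _≈_)
    side : ∀ k → Dec (domain A k) → Carrier
    side k (yes m) = inj₁ (k , lift m)
    side k (no ¬m) = inj₂ (k , lift ¬m)
    side-cong : ∀ k k′ d d′ → k K.≈ k′ → side k d ≈ side k′ d′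
    side-cong k k′ (yes _) (yes _) p = inj₁ p
    side-cong k k′ (no _) (no _) p = inj₂ p
    side-cong k k′ (yes m) (no ¬m) p = contradiction (domain-resp p m) ¬m
    side-cong k k′ (no ¬m) (yes m) p = contradiction (domain-resp (K.sym p) m) ¬m
    side-injective : ∀ k k′ d d′ → side k d ≈ side k′ d′ → k K.≈ k′
    side-injective k k′ (yes _) (yes _) (inj₁ p) = p
    side-injective k k′ (no _) (no _) (inj₂ p) = p

  -- If the domain embedded into its complement, its image there would be a fresh set of the same
  -- size, large enough to code all new pairs, and the pairing would extend.
  maximal-absorbs : ∀ {A} → Maximal A → ∃ (λ k → Lift ℓ (domain A k)) →
    (A on true) ≤ᶜ (A on false) ⊎ (A on false) ≤ᶜ (A on true) → (A on false) ≤ᶜ (A on true)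
  maximal-absorbs {A} max@(A-pairing , _) x₀ (inj₁ X≤Y) = contradiction max
    (Extension.not-maximal A-pairing {I = A on true} (≤ᶜ-trans X≤Y (A on false ⊆K)) x₀
      (λ i → lower (proj₂ (Injection.to X≤Y i))) (square-⊎-≤ (on-square A-pairing)))
  maximal-absorbs _ _ (inj₂ Y≤X) = Y≤X

  -- With X the domain and Y its complement, K ≤ X + Y ≤ X + X ≤ X · X ≤ X, so K inherits the
  -- pairing of X.
  square-of-maximal : ∀ {A} → IsPairing A → (A on false) ≤ᶜ (A on true) → Square K ≤ᶜ K
  square-of-maximal {A} A-pairing Y≤X =
    ≤ᶜ-trans (square-map K≤X) (≤ᶜ-trans square-X (A on true ⊆K))
    where
    square-X = on-square A-pairing
    K≤X : K ≤ᶜ (A on true)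
    K≤X = ≤ᶜ-trans (split A-pairing) (≤ᶜ-trans (Identity.injection (A on true) ⊎-injection Y≤X)
      (≤ᶜ-trans (⊎-≤-square (A on true)) square-X))

  abstract
    square-≤ : Infinite K → Square K ≤ᶜ K
    square-≤ ω≤K = let A , max = zorn in square-of-maximal (proj₁ max)
      (maximal-absorbs max (maximal-nonempty ω≤K max)
        (Comparability.comparable ac (A on true) (A on false)))

-- Small subsets

Finite : Cardinal a → Set _
Finite X = ∃ λ xs → ∀ x → Membership._∈_ X x xs

module FiniteOrInfinite (ac : AxiomOfChoice ℓ) (X : Cardinal ℓ) where

  open Choice ac
  private module X = Setoid X
  open Membership X using () renaming (_∈_ to _∈ˢ_; _∉_ to _∉ˢ_)

  -- Each point avoids the list of its predecessors. As ℕ carries propositional equality, the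
  -- sequence is automatically a map of setoids.
  infinite-of-fresh : (∀ xs → ∃ λ x → x ∉ˢ xs) → Infinite X
  infinite-of-fresh fresh = record
    { to = point
    ; cong = λ { refl → X.refl }
    ; injective = λ {m} {n} → injective m n
    }
    where
    initial : ℕ → List X.Carrier
    initial zero    = []
    initial (suc n) = proj₁ (fresh (initial n)) ∷ initial n
    point : ℕ → X.Carrier
    point n = proj₁ (fresh (initial n))
    point∈initial : ∀ {m} n → m < n → point m ∈ˢ initial n
    point∈initial (suc n) m<1+n with m<1+n⇒m<n∨m≡n m<1+n
    ... | inj₁ m<n = there (point∈initial n m<n)
    ... | inj₂ refl = here X.refl
    distinct : ∀ {m n} → m < n → ¬ point n X.≈ point m
    distinct {n = n} m<n p = proj₂ (fresh (initial n))
      (Membershipₚ.∈-resp-≈ X (X.sym p) (point∈initial n m<n))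
    injective : ∀ m n → point m X.≈ point n → m ≡ n
    injective m n p with <-cmp m n
    ... | tri< m<n _ _ = contradiction (X.sym p) (distinct m<n)
    ... | tri≈ _ m≡n _ = m≡n
    ... | tri> _ _ n<m = contradiction p (distinct n<m)

  finite-or-infinite : Finite X ⊎ Infinite X
  finite-or-infinite with em {∀ xs → ∃ λ x → x ∉ˢ xs}
  ... | yes fresh = inj₂ (infinite-of-fresh fresh)
  ... | no ¬fresh = let xs , ¬∃ = ¬∀⇒∃¬ ¬fresh in
    inj₁ (xs , λ x → dne λ x∉xs → ¬∃ (x , x∉xs))

module SmallSubsets (ac : AxiomOfChoice ℓ) {Λ : Cardinal ℓ} (ω≤Λ : Infinite Λ) where

  open Choice ac
  private module Λ = Setoid Λ

  finite-small : {S : Setoid ℓ ℓ} (X : Pred (Setoid.Carrier S) ℓ) (xs : List (Setoid.Carrier S)) →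
    (∀ {x} → x ∈ X → Membership._∈_ S x xs) → ∣_∣ {S = S} X <ᶜ Λ
  finite-small {S} X xs covered = ≤ᶜ-trans X≤Fin (≤ᶜ-trans Fin≤ℕ ω≤Λ) ,
      λ Λ≤X → let ω≤Fin = ≤ᶜ-trans ω≤Λ (≤ᶜ-trans Λ≤X X≤Fin) in
        ℕ→Fin-notInjective (λ n → lower (Injection.to ω≤Fin n))
          (λ p → Injection.injective ω≤Fin (cong lift p))
    where
    open Setoid S using (_≈_) renaming (sym to ≈-sym; trans to ≈-trans)
    fin : Cardinal ℓ
    fin = setoid (Lift ℓ (Fin (length xs)))
    Fin≤ℕ : fin ≤ᶜ setoid ℕ
    Fin≤ℕ = record
      { to = λ i → toℕ (lower i)
      ; cong = λ { refl → refl }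
      ; injective = λ p → cong lift (toℕ-injective p)
      }
    -- The position found for a point depends on its membership proof, so a map that respects
    -- equality has to come from choice.
    X≤Fin : ∣_∣ {S = S} X ≤ᶜ fin
    X≤Fin = ≤ᶜ-via (λ i (x , _) → x ≈ lookup xs (lower i))
      (λ (x , x∈X) → lift (index (covered x∈X)) , lookup-index (covered x∈X))
      (λ { p q refl → ≈-trans p (≈-sym q) })

  image : {S S′ : Setoid ℓ ℓ} → Func S S′ → SmallSubset S Λ → SmallSubset S′ Λ
  image {S} {S′} h X = record
    { elements = λ y → ∃ λ x → x ∈ elements X × (h ⟨$⟩ x) ≈ y
    ; resp = λ y≈y′ (x , x∈X , p) → x , x∈X , ≈-trans p y≈y′
    ; small = ≤ᶜ-<ᶜ-trans (≤ᶜ-via (λ (x , _) (y , _) → (h ⟨$⟩ x) ≈ y)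
        (λ (y , x , x∈X , p) → (x , x∈X) , p)
        (λ p p′ x≈x′ → ≈-trans (≈-sym p) (≈-trans (Func.cong h x≈x′) p′))) (small X)
    }
    where open Setoid S′ using (_≈_) renaming (sym to ≈-sym; trans to ≈-trans)

  ∅ : {S : Setoid ℓ ℓ} → SmallSubset S Λ
  ∅ {S} = record
    { elements = λ _ → Lift ℓ ⊥
    ; resp = λ _ ()
    ; small = finite-small {S} (λ _ → Lift ℓ ⊥) [] (λ ())
    }

  module _ {S : Setoid ℓ ℓ} (X Y : SmallSubset S Λ) where

    private
      open Setoid S using (Carrier; _≈_) renaming (refl to ≈-refl; sym to ≈-sym; trans to ≈-trans)

      union : Pred Carrier ℓ
      union z = z ∈ elements X ⊎ z ∈ elements Y

      square-Λ : Square Λ ≤ᶜ Λ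
      square-Λ = InfiniteSquare.square-≤ ac Λ ω≤Λ

      union≤ : ∣_∣ {S = S} union ≤ᶜ (∣_∣ {S = S} (elements X) ⊎ₛ ∣_∣ {S = S} (elements Y))
      union≤ = ≤ᶜ-via (λ t (z , _) → point t ≈ z)
          (λ { (z , inj₁ z∈X) → inj₁ (z , z∈X) , ≈-refl
             ; (z , inj₂ z∈Y) → inj₂ (z , z∈Y) , ≈-refl })
          (λ p p′ t≈t′ → ≈-trans (≈-sym p) (≈-trans (point-cong t≈t′) p′))
        where
        sum = ∣_∣ {S = S} (elements X) ⊎ₛ ∣_∣ {S = S} (elements Y)
        point : Setoid.Carrier sum → Carrier
        point = [ proj₁ , proj₁ ]′
        point-cong : ∀ {t t′} → Setoid._≈_ sum t t′ → point t ≈ point t′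
        point-cong (inj₁ p) = p
        point-cong (inj₂ p) = p

      -- Read Λ as Λ × Λ: either some row embeds into X, or Y contains a point of every row.
      union≱ : ¬ Λ ≤ᶜ ∣_∣ {S = S} union
      union≱ Λ≤union = proj₂ (small Y) (≤ᶜ-via
          (λ (y , _) k → ∃ λ l → point k l ≈ y)
          (λ k → let l , cell∉X = ¬∀⇒∃¬ (no-row k) in
            (_ , [ (λ x → contradiction x cell∉X) , id ]′ (proj₂ (cell k l))) , l , ≈-refl)
          (λ (l , p) (l′ , p′) y≈y′ →
            proj₁ (point-injective (≈-trans p (≈-trans y≈y′ (≈-sym p′))))))
        where
        grid : Square Λ ≤ᶜ ∣_∣ {S = S} union
        grid = ≤ᶜ-trans square-Λ Λ≤union
        cell : Λ.Carrier → Λ.Carrier → ∃ union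
        cell k l = Injection.to grid (true , k , l)
        point : Λ.Carrier → Λ.Carrier → Carrier
        point k l = proj₁ (cell k l)
        point-injective : ∀ {k l k′ l′} → point k l ≈ point k′ l′ → k Λ.≈ k′ × l Λ.≈ l′
        point-injective p = proj₂ (Injection.injective grid p)
        no-row : ∀ k → ¬ (∀ l → point k l ∈ elements X)
        no-row k row⊆X = proj₂ (small X) (record
          { to = λ l → point k l , row⊆X l
          ; cong = λ l≈l′ → Injection.cong grid (refl , Λ.refl , l≈l′)
          ; injective = λ p → proj₂ (point-injective p)
          })

    _∪_ : SmallSubset S Λ
    _∪_ = record
      { elements = union
      ; resp = λ { p (inj₁ x) → inj₁ (resp X p x) ; p (inj₂ y) → inj₂ (resp Y p y) }
      ; small = ≤ᶜ-trans union≤ (≤ᶜ-trans (proj₁ (small X) ⊎-injection proj₁ (small Y))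
          (≤ᶜ-trans (⊎-≤-square Λ) square-Λ)) , union≱
      }

  ⋃ : {A : Set a} {S : Setoid ℓ ℓ} → (A → SmallSubset S Λ) → List A → SmallSubset S Λ
  ⋃ F = List.foldr (λ x X → F x ∪ X) ∅

  ∈-⋃ : {A : Set a} {S : Setoid ℓ ℓ} {F : A → SmallSubset S Λ} {x : A} {xs : List A}
    {z : Setoid.Carrier S} → x ∈ˡ xs → z ∈ elements (F x) → z ∈ elements (⋃ F xs)
  ∈-⋃ (here refl) z∈Fx = inj₁ z∈Fx
  ∈-⋃ {S = S} {F = F} (there x∈xs) z∈Fx = inj₂ (∈-⋃ {S = S} {F = F} x∈xs z∈Fx)

-- Generated sublattices and their size

module Sublattice (A : BooleanAlgebra a a) where

  open BooleanAlgebra A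
    renaming (setoid to S; refl to ≈-refl; sym to ≈-sym; trans to ≈-trans; ⊥ to 𝟘; ⊤ to 𝟙; ¬_ to ∁_)
  open BooleanAlgebraProperties A
  open Membership S using () renaming (_∈_ to _∈ˢ_)

  ∨-commutativeSemigroup ∧-commutativeSemigroup : CommutativeSemigroup a a
  ∨-commutativeSemigroup = record
    { isCommutativeSemigroup = record { isSemigroup = ∨-isSemigroup ; comm = ∨-comm } }
  ∧-commutativeSemigroup = record
    { isCommutativeSemigroup = record { isSemigroup = ∧-isSemigroup ; comm = ∧-comm } }

  bound : Bool → Carrier
  bound b = if b then 𝟙 else 𝟘

  op : Bool → Carrier → Carrier → Carrier
  op b x y = if b then x ∧ y else x ∨ y

  op-cong : ∀ {b b′ x x′ y y′} → b ≡ b′ → x ≈ x′ → y ≈ y′ → op b x y ≈ op b′ x′ y′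
  op-cong {true}  refl p q = ∧-cong p q
  op-cong {false} refl p q = ∨-cong p q

  -- The equations in the constructors make membership invariant under equality. The Boolean indices
  -- let one tag of a code record which bound or which operation was used.
  data Generated (G : Pred Carrier a) : Pred Carrier a where
    isBound     : ∀ b {z} → z ≈ bound b → Generated G z
    isGenerator : ∀ {z} → z ∈ G → Generated G z
    isOp        : ∀ b {x y z} → Generated G x → Generated G y → z ≈ op b x y → Generated G z

  generated-resp : ∀ {G} → G Respects _≈_ → Generated G Respects _≈_
  generated-resp r z≈z′ (isBound b p) = isBound b (≈-trans (≈-sym z≈z′) p)
  generated-resp r z≈z′ (isGenerator g) = isGenerator (r z≈z′ g)
  generated-resp r z≈z′ (isOp b x y p) = isOp b x y (≈-trans (≈-sym z≈z′) p)

  record IsSublattice (L : List Carrier) : Set a where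
    field
      bound∈ : ∀ b → bound b ∈ˢ L
      op∈    : ∀ b {x y} → x ∈ˢ L → y ∈ˢ L → op b x y ∈ˢ L

  -- Adjoining g to a sublattice L adds just the elements s ∨ (t ∧ g) with s, t in L.

  infix 8 _⟪_⟫_
  _⟪_⟫_ : Carrier → Carrier → Carrier → Carrier
  s ⟪ g ⟫ t = s ∨ (t ∧ g)

  ⟪⟫-cong : ∀ {g s s′ t t′} → s ≈ s′ → t ≈ t′ → s ⟪ g ⟫ t ≈ s′ ⟪ g ⟫ t′
  ⟪⟫-cong p q = ∨-cong p (∧-congʳ q)

  open import Relation.Binary.Reasoning.Setoid S

  ⟪⟫-∨ : ∀ g s t s′ t′ → s ⟪ g ⟫ t ∨ s′ ⟪ g ⟫ t′ ≈ (s ∨ s′) ⟪ g ⟫ (t ∨ t′)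
  ⟪⟫-∨ g s t s′ t′ = begin
    (s ∨ t ∧ g) ∨ (s′ ∨ t′ ∧ g)   ≈⟨ ∨-interchange s (t ∧ g) s′ (t′ ∧ g) ⟩
    (s ∨ s′) ∨ (t ∧ g ∨ t′ ∧ g)   ≈⟨ ∨-congˡ (∧-distribʳ-∨ g t t′) ⟨
    (s ∨ s′) ∨ ((t ∨ t′) ∧ g)     ∎
    where
    open CommutativeSemigroupProperties ∨-commutativeSemigroup
      renaming (interchange to ∨-interchange)

  -- Multiplying out, the three terms that contain g collect into one, since g ∧ g = g.
  ⟪⟫-∧ : ∀ g s t s′ t′ → s ⟪ g ⟫ t ∧ s′ ⟪ g ⟫ t′ ≈
    (s ∧ s′) ⟪ g ⟫ ((s ∧ t′) ∨ ((t ∧ s′) ∨ (t ∧ t′)))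
  ⟪⟫-∧ g s t s′ t′ = begin
    (s ∨ tg) ∧ (s′ ∨ t′g)                                 ≈⟨ ∧-distribʳ-∨ _ s tg ⟩
    s ∧ (s′ ∨ t′g) ∨ tg ∧ (s′ ∨ t′g)                      ≈⟨ ∨-cong (∧-distribˡ-∨ _ _ _) (∧-distribˡ-∨ _ _ _) ⟩
    (s ∧ s′ ∨ s ∧ t′g) ∨ (tg ∧ s′ ∨ tg ∧ t′g)             ≈⟨ ∨-assoc _ _ _ ⟩
    s ∧ s′ ∨ (s ∧ t′g ∨ (tg ∧ s′ ∨ tg ∧ t′g))
      ≈⟨ ∨-congˡ (∨-cong (≈-sym (∧-assoc s t′ g)) (∨-cong middle last)) ⟩
    s ∧ s′ ∨ ((s ∧ t′) ∧ g ∨ ((t ∧ s′) ∧ g ∨ (t ∧ t′) ∧ g)) ≈⟨ ∨-congˡ (∨-congˡ (∧-distribʳ-∨ g _ _)) ⟨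
    s ∧ s′ ∨ ((s ∧ t′) ∧ g ∨ ((t ∧ s′) ∨ (t ∧ t′)) ∧ g)   ≈⟨ ∨-congˡ (∧-distribʳ-∨ g _ _) ⟨
    s ∧ s′ ∨ ((s ∧ t′) ∨ ((t ∧ s′) ∨ (t ∧ t′))) ∧ g       ∎
    where
    tg = t ∧ g
    t′g = t′ ∧ g
    middle : (t ∧ g) ∧ s′ ≈ (t ∧ s′) ∧ g
    middle = ≈-trans (∧-assoc t g s′) (≈-trans (∧-congˡ (∧-comm g s′)) (≈-sym (∧-assoc t s′ g)))
    last : (t ∧ g) ∧ (t′ ∧ g) ≈ (t ∧ t′) ∧ g
    last = ≈-trans (∧-interchange t g t′ g) (∧-congˡ (∧-idem g))
      where
      open CommutativeSemigroupProperties ∧-commutativeSemigroup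
        renaming (interchange to ∧-interchange)

  adjoin : Carrier → List Carrier → List Carrier
  adjoin g L = cartesianProductWith (λ s t → s ⟪ g ⟫ t) L L

  module _ {g : Carrier} {L : List Carrier} (L-sub : IsSublattice L) where

    open IsSublattice L-sub

    ∈-adjoin : ∀ {s t z} → s ∈ˢ L → t ∈ˢ L → z ≈ s ⟪ g ⟫ t → z ∈ˢ adjoin g L
    ∈-adjoin s∈L t∈L z≈ = Membershipₚ.∈-resp-≈ S (≈-sym z≈)
      (Membershipₚ.∈-cartesianProductWith⁺ S S S ⟪⟫-cong s∈L t∈L)

    adjoin⁻ : ∀ {z} → z ∈ˢ adjoin g L → ∃₂ λ s t → s ∈ˢ L × t ∈ˢ L × z ≈ s ⟪ g ⟫ t
    adjoin⁻ = Membershipₚ.∈-cartesianProductWith⁻ S S S (λ s t → s ⟪ g ⟫ t) L L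

    adjoin-⊇ : ∀ {x} → x ∈ˢ L → x ∈ˢ adjoin g L
    adjoin-⊇ {x} x∈L = ∈-adjoin x∈L (bound∈ false)
      (≈-sym (≈-trans (∨-congˡ (∧-zeroˡ g)) (∨-identityʳ x)))

    adjoin-∋ : g ∈ˢ adjoin g L
    adjoin-∋ = ∈-adjoin (bound∈ false) (bound∈ true)
      (≈-sym (≈-trans (∨-identityˡ _) (∧-identityˡ g)))

    adjoin-isSublattice : IsSublattice (adjoin g L)
    adjoin-isSublattice = record
      { bound∈ = λ b → adjoin-⊇ (bound∈ b)
      ; op∈ = λ b x∈ y∈ → op∈′ b (adjoin⁻ x∈) (adjoin⁻ y∈)
      }
      where
      Member : Carrier → Set _
      Member z = ∃₂ λ s t → s ∈ˢ L × t ∈ˢ L × z ≈ s ⟪ g ⟫ t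
      op∈′ : ∀ b {x y} → Member x → Member y → op b x y ∈ˢ adjoin g L
      op∈′ true (s , t , s∈ , t∈ , p) (s′ , t′ , s′∈ , t′∈ , p′) =
        ∈-adjoin (op∈ true s∈ s′∈)
          (op∈ false (op∈ true s∈ t′∈) (op∈ false (op∈ true t∈ s′∈) (op∈ true t∈ t′∈)))
          (≈-trans (∧-cong p p′) (⟪⟫-∧ g s t s′ t′))
      op∈′ false (s , t , s∈ , t∈ , p) (s′ , t′ , s′∈ , t′∈ , p′) =
        ∈-adjoin (op∈ false s∈ s′∈) (op∈ false t∈ t′∈) (≈-trans (∨-cong p p′) (⟪⟫-∨ g s t s′ t′))

  two : IsSublattice (𝟘 ∷ 𝟙 ∷ [])
  two = record { bound∈ = bound∈ ; op∈ = λ b → op∈ b }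
    where
    bound∈ : ∀ b → bound b ∈ˢ (𝟘 ∷ 𝟙 ∷ [])
    bound∈ false = here ≈-refl
    bound∈ true = there (here ≈-refl)
    op∈ : ∀ b {x y} → x ∈ˢ (𝟘 ∷ 𝟙 ∷ []) → y ∈ˢ (𝟘 ∷ 𝟙 ∷ []) → op b x y ∈ˢ (𝟘 ∷ 𝟙 ∷ [])
    op∈ true (here p) _ = here (≈-trans (∧-congʳ p) (∧-zeroˡ _))
    op∈ true (there (here p)) q = Membershipₚ.∈-resp-≈ S (≈-sym (≈-trans (∧-congʳ p) (∧-identityˡ _))) q
    op∈ false (here p) q = Membershipₚ.∈-resp-≈ S (≈-sym (≈-trans (∨-congʳ p) (∨-identityˡ _))) q
    op∈ false (there (here p)) _ = there (here (≈-trans (∨-congʳ p) (∨-zeroˡ _)))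

  finitely-generated : ∀ gs → ∃ λ L → IsSublattice L × (∀ {g} → g ∈ˢ gs → g ∈ˢ L)
  finitely-generated [] = _ , two , λ ()
  finitely-generated (g ∷ gs) = let L , L-sub , gs⊆L = finitely-generated gs in
    adjoin g L , adjoin-isSublattice L-sub ,
    λ { (here p) → Membershipₚ.∈-resp-≈ S (≈-sym p) (adjoin-∋ L-sub)
      ; (there h) → adjoin-⊇ L-sub (gs⊆L h) }

  generated⊆ : ∀ {G L} → IsSublattice L → (∀ {g} → g ∈ G → g ∈ˢ L) → ∀ {z} → Generated G z → z ∈ˢ L
  generated⊆ L-sub G⊆L (isBound b p) = Membershipₚ.∈-resp-≈ S (≈-sym p) (IsSublattice.bound∈ L-sub b)
  generated⊆ L-sub G⊆L (isGenerator g) = G⊆L g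
  generated⊆ L-sub G⊆L (isOp b x y p) = Membershipₚ.∈-resp-≈ S (≈-sym p)
    (IsSublattice.op∈ L-sub b (generated⊆ L-sub G⊆L x) (generated⊆ L-sub G⊆L y))

  module Coding {G : Pred Carrier a} (s : Square (∣_∣ {S = S} G) ≤ᶜ ∣_∣ {S = S} G) (w : ∃ G) where

    private
      module s = Injection s
      pack : Bool → ∃ G → ∃ G → ∃ G
      pack b x y = s.to (b , x , y)

    code : ∀ {z} → Generated G z → ∃ G
    code (isBound b _)         = pack false (pack false w w) (pack b w w)
    code (isGenerator {z} z∈G) = pack false (pack true w w) (z , z∈G)
    code (isOp b x y _)        = pack true (pack b w (code x)) (code y)

    -- A code recovers the value up to equality, not the derivation, and counting the generated
    -- elements asks for no more.
    code-injective : ∀ {z z′} (d : Generated G z) (d′ : Generated G z′) →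
      proj₁ (code d) ≈ proj₁ (code d′) → z ≈ z′
    code-injective (isBound b p) (isBound b′ p′) e
      with refl , _ ← s.injective (proj₂ (proj₂ (s.injective e))) = ≈-trans p (≈-sym p′)
    code-injective (isGenerator _) (isGenerator _) e = proj₂ (proj₂ (s.injective e))
    code-injective (isOp b x y p) (isOp b′ x′ y′ p′) e =
      let _ , e₁ , e₂ = s.injective e
          b≡b′ , _ , e₃ = s.injective e₁ in
      ≈-trans p (≈-trans (op-cong b≡b′ (code-injective x x′ e₃) (code-injective y y′ e₂)) (≈-sym p′))
    code-injective (isBound _ _) (isGenerator _) e with () ← s.injective (proj₁ (proj₂ (s.injective e)))
    code-injective (isGenerator _) (isBound _ _) e with () ← s.injective (proj₁ (proj₂ (s.injective e)))
    code-injective (isBound _ _) (isOp _ _ _ _) e with () ← s.injective e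
    code-injective (isGenerator _) (isOp _ _ _ _) e with () ← s.injective e
    code-injective (isOp _ _ _ _) (isBound _ _) e with () ← s.injective e
    code-injective (isOp _ _ _ _) (isGenerator _) e with () ← s.injective e

module SmallSublattice (ac : AxiomOfChoice ℓ) {Λ : Cardinal ℓ} (ω≤Λ : Infinite Λ)
  (A : BooleanAlgebra ℓ ℓ) where

  open Choice ac
  open BooleanAlgebra A using (_≈_) renaming (setoid to S)
  open Sublattice A

  -- A bound by `Λ` would not be strict. So an infinite `G` is paired with itself, which codes all
  -- derivations by elements of `G`; a finite `G` generates a finite lattice, which is small for
  -- every infinite `Λ`.
  generated-small : (G : Pred (Setoid.Carrier S) ℓ) → ∣_∣ {S = S} G <ᶜ Λ →
    Finite (∣_∣ {S = S} G) ⊎ Infinite (∣_∣ {S = S} G) → ∣_∣ {S = S} (Generated G) <ᶜ Λ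
  generated-small G _ (inj₁ (gs , covered)) =
    let L , L-sub , gs⊆L = finitely-generated (List.map proj₁ gs) in
    SmallSubsets.finite-small ac ω≤Λ (Generated G) L (generated⊆ L-sub λ g∈G →
      gs⊆L (Membershipₚ.∈-map⁺ (∣_∣ {S = S} G) S {f = proj₁} (λ p → p) {v = _ , g∈G}
        (covered (_ , g∈G))))
  generated-small G G<Λ (inj₂ ω≤G) = ≤ᶜ-<ᶜ-trans
    (≤ᶜ-via (λ g (z , _) → ∃ λ (d : Generated G z) → proj₁ g ≈ proj₁ (code d))
      (λ (z , d) → code d , d , ≈-refl)
      (λ (d , p) (d′ , p′) g≈g′ → code-injective d d′ (≈-trans (≈-sym p) (≈-trans g≈g′ p′)))) G<Λ
    where
    open Setoid S using () renaming (refl to ≈-refl; sym to ≈-sym; trans to ≈-trans)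
    open Coding (InfiniteSquare.square-≤ ac (∣_∣ {S = S} G) ω≤G) (Injection.to ω≤G 0)

  generated : SmallSubset S Λ → SmallSubset S Λ
  generated G = record
    { elements = Generated (elements G)
    ; resp = generated-resp (resp G)
    ; small = generated-small (elements G) (small G)
        (FiniteOrInfinite.finite-or-infinite ac (∣_∣ {S = S} (elements G)))
    }

-- Boolean algebras and interpolation in the exponential

module BooleanOrder (A : BooleanAlgebra a b) where

  open BooleanAlgebra A public
    renaming (refl to ≈-refl; sym to ≈-sym; trans to ≈-trans; ⊥ to 𝟘; ⊤ to 𝟙; ¬_ to ∁_)
  open BooleanAlgebraProperties A public
    using (∧-identityʳ; ∧-identityˡ; ∨-identityˡ; ∨-identityʳ; ∧-zeroʳ; ∧-zeroˡ
          ; deMorgan₁; deMorgan₂; ∨-∧-orderTheoreticLattice)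
    renaming (¬-involutive to ∁-involutive; ¬⊥≈⊤ to ∁𝟘≈𝟙; ¬⊤≈⊥ to ∁𝟙≈𝟘)
  open Lattice ∨-∧-orderTheoreticLattice public
    using (_≤_; x≤x∨y; y≤x∨y; ∨-least; x∧y≤x; x∧y≤y; ∧-greatest; poset)
    renaming (refl to ≤-refl; trans to ≤-trans; reflexive to ≤-reflexive)
  open import Relation.Binary.Reasoning.PartialOrder poset

  𝟘≤ : ∀ x → 𝟘 ≤ x
  𝟘≤ x = ≈-sym (∧-zeroˡ x)

  ≤𝟙 : ∀ x → x ≤ 𝟙
  ≤𝟙 x = ≈-sym (∧-identityʳ x)

  ∧-mono : ∀ {x x′ y y′} → x ≤ x′ → y ≤ y′ → x ∧ y ≤ x′ ∧ y′
  ∧-mono p q = ∧-greatest (≤-trans (x∧y≤x _ _) p) (≤-trans (x∧y≤y _ _) q)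

  ≤∁⇒≤𝟘 : ∀ {x y} → x ≤ y → x ≤ ∁ y → x ≤ 𝟘
  ≤∁⇒≤𝟘 {x} {y} p q = ≤-trans (∧-greatest p q) (≤-reflexive (∧-complementʳ y))

  resolve : ∀ {x y z} → x ≤ y ∨ z → x ≤ ∁ y → x ≤ z
  resolve {x} {y} {z} p q = begin
    x                       ≤⟨ ∧-greatest q p ⟩
    ∁ y ∧ (y ∨ z)           ≈⟨ ∧-distribˡ-∨ (∁ y) y z ⟩
    ∁ y ∧ y ∨ ∁ y ∧ z       ≤⟨ ∨-least (≤-trans (≤-reflexive (∧-complementˡ y)) (𝟘≤ z)) (x∧y≤y _ _) ⟩
    z                       ∎

  shift : ∀ {x y z} → x ∧ y ≤ z → x ≤ ∁ y ∨ z
  shift {x} {y} {z} p = begin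
    x                       ≈⟨ ∧-identityʳ x ⟨
    x ∧ 𝟙                   ≈⟨ ∧-congˡ (∨-complementʳ y) ⟨
    x ∧ (y ∨ ∁ y)           ≈⟨ ∧-distribˡ-∨ x y (∁ y) ⟩
    x ∧ y ∨ x ∧ ∁ y         ≤⟨ ∨-least (≤-trans p (y≤x∨y _ _)) (≤-trans (x∧y≤y _ _) (x≤x∨y _ _)) ⟩
    ∁ y ∨ z                 ∎

  unshift : ∀ {x y z} → x ≤ ∁ y ∨ z → x ∧ y ≤ z
  unshift {y = y} p = resolve (≤-trans (x∧y≤x _ _) p)
    (≤-trans (x∧y≤y _ _) (≤-reflexive (≈-sym (∁-involutive y))))

  disjoint⇒≤∁ : ∀ {x y} → x ∧ y ≤ 𝟘 → x ≤ ∁ y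
  disjoint⇒≤∁ p = ≤-trans (shift p) (≤-reflexive (∨-identityʳ _))

  ≤∁⇒disjoint : ∀ {x y} → x ≤ ∁ y → x ∧ y ≤ 𝟘
  ≤∁⇒disjoint p = unshift (≤-trans p (x≤x∨y _ _))

  ≤∁-sym : ∀ {x y} → x ≤ ∁ y → y ≤ ∁ x
  ≤∁-sym p = disjoint⇒≤∁ (≤-trans (≤-reflexive (∧-comm _ _)) (≤∁⇒disjoint p))

  ∁-anti : ∀ {x y} → x ≤ y → ∁ y ≤ ∁ x
  ∁-anti {y = y} p = ≤∁-sym (≤-trans p (≤-reflexive (≈-sym (∁-involutive y))))

  exchange : ∀ {x y z} → x ∧ ∁ y ≤ z → x ∧ ∁ z ≤ y
  exchange {x} {y} {z} p = resolve (≤-trans (x∧y≤x _ _) (begin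
    x             ≤⟨ shift p ⟩
    ∁ ∁ y ∨ z     ≈⟨ ∨-congʳ (∁-involutive y) ⟩
    y ∨ z         ≈⟨ ∨-comm y z ⟩
    z ∨ y         ∎)) (x∧y≤y _ _)

  ⋁ : List Carrier → Carrier
  ⋁ = foldr _∨_ 𝟘

  ≤-⋁ : ∀ {x xs} → x ∈ˡ xs → x ≤ ⋁ xs
  ≤-⋁ (here refl) = x≤x∨y _ _
  ≤-⋁ (there x∈xs) = ≤-trans (≤-⋁ x∈xs) (y≤x∨y _ _)

  ⋁-++ : ∀ xs ys → ⋁ (xs ++ ys) ≈ ⋁ xs ∨ ⋁ ys
  ⋁-++ [] ys = ≈-sym (∨-identityˡ _)
  ⋁-++ (x ∷ xs) ys = ≈-trans (∨-congˡ (⋁-++ xs ys)) (≈-sym (∨-assoc _ _ _))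

module Interpolation (A : BooleanAlgebra a a) where

  open BooleanOrder A
  open Sublattice A using (Generated; isBound; isOp)

  module _ {G H : Pred Carrier a} where

    Between : Carrier → Carrier → Set a
    Between x y = ∃ λ z → z ∈ Generated G ∩ Generated H × x ≤ z × z ≤ y

    -- From interpolants z for each pair (x , y), take the join over x of the meets over y. Empty
    -- lists give 0 and 1, which is why the bounds count as generated.
    between-⋁ : ∀ xs ys → (∀ {x y} → x ∈ˡ xs → y ∈ˡ ys → Between x (∁ y)) →
      Between (⋁ xs) (∁ (⋁ ys))
    between-⋁ [] ys _ = 𝟘 , (isBound false ≈-refl , isBound false ≈-refl) , ≤-refl , 𝟘≤ _
    between-⋁ (x ∷ xs) ys between =
      let z , (zG , zH) , x≤z , z≤ = row ys (between (here refl))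
          w , (wG , wH) , xs≤w , w≤ = between-⋁ xs ys (λ x∈ → between (there x∈))
      in z ∨ w , (isOp false zG wG ≈-refl , isOp false zH wH ≈-refl) ,
         ∨-least (≤-trans x≤z (x≤x∨y _ _)) (≤-trans xs≤w (y≤x∨y _ _)) , ∨-least z≤ w≤
      where
      row : ∀ ys → (∀ {y} → y ∈ˡ ys → Between x (∁ y)) → Between x (∁ (⋁ ys))
      row [] _ = 𝟙 , (isBound true ≈-refl , isBound true ≈-refl) , ≤𝟙 _ , ≤-reflexive (≈-sym ∁𝟘≈𝟙)
      row (y ∷ ys) between =
        let z , (zG , zH) , x≤z , z≤ = between (here refl)
            w , (wG , wH) , x≤w , w≤ = row ys (λ y∈ → between (there y∈))
        in z ∧ w , (isOp true zG wG ≈-refl , isOp true zH wH ≈-refl) ,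
           ∧-greatest x≤z x≤w , ≤-trans (∧-mono z≤ w≤) (≤-reflexive (≈-sym (deMorgan₂ _ _)))

-- Clauses, normal forms and separation in the exponential

module Clauses (B : BooleanAlgebra ℓ ℓ) where

  open Exponential B hiding (exp)
  private
    module B = BooleanOrder B
    module E = BooleanOrder (exp B)

  gen-∧-≤ : ∀ {r s t} → r B.∧ s B.≤ t → [ r ] ∧′ [ s ] E.≤ [ t ]
  gen-∧-≤ p = E.≤-trans (E.≤-reflexive (gen-∧ _ _)) (gen-mono p)

  Clause : Set ℓ
  Clause = B.Carrier × List B.Carrier

  -- (a , bs) stands for [ a ] ∧ ¬ [ b₁ ] ∧ … ∧ ¬ [ bₙ ].

  joins : List B.Carrier → Term
  joins bs = E.⋁ (map [_] bs)

  clause : Clause → Term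
  clause (a , bs) = [ a ] ∧′ ¬′ joins bs

  ⋁ᶜ : List Clause → Term
  ⋁ᶜ cs = E.⋁ (map clause cs)

  infixr 7 _·_ _⊗_
  _·_ : Clause → Clause → Clause
  (a , bs) · (c , ds) = a B.∧ c , bs ++ ds

  _⊗_ : List Clause → List Clause → List Clause
  _⊗_ = cartesianProductWith _·_

  signed : Bool → Term → Term
  signed true  t = t
  signed false t = ¬′ t

  -- Carrying the sign inward keeps the recursion structural. Both signs are used: t ≤ u means that
  -- the clauses of t are disjoint from those of ¬ u.
  dnf : Bool → Term → List Clause
  dnf true  [ a ]     = (a , []) ∷ []
  dnf false [ a ]     = (B.𝟙 , a ∷ []) ∷ []
  dnf true  (t ∨′ u)  = dnf true t ++ dnf true u
  dnf false (t ∨′ u)  = dnf false t ⊗ dnf false u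
  dnf true  (t ∧′ u)  = dnf true t ⊗ dnf true u
  dnf false (t ∧′ u)  = dnf false t ++ dnf false u
  dnf s     (¬′ t)    = dnf (not s) t
  dnf true  ⊤′        = (B.𝟙 , []) ∷ []
  dnf false ⊤′        = []
  dnf true  ⊥′        = []
  dnf false ⊥′        = (B.𝟙 , []) ∷ []

  open import Relation.Binary.Reasoning.Setoid E.setoid

  ⋁ᶜ-++ : ∀ cs ds → ⋁ᶜ (cs ++ ds) ∼ ⋁ᶜ cs ∨′ ⋁ᶜ ds
  ⋁ᶜ-++ cs ds rewrite map-++ clause cs ds = E.⋁-++ (map clause cs) (map clause ds)

  joins-++ : ∀ bs ds → joins (bs ++ ds) ∼ joins bs ∨′ joins ds
  joins-++ bs ds rewrite map-++ [_] bs ds = E.⋁-++ (map [_] bs) (map [_] ds)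

  clause-· : ∀ C D → clause (C · D) ∼ clause C ∧′ clause D
  clause-· (a , bs) (c , ds) = begin
    [ a B.∧ c ] ∧′ ¬′ joins (bs ++ ds)
      ≈⟨ ∧-cong (∼-sym (gen-∧ a c)) (¬-cong (joins-++ bs ds)) ⟩
    ([ a ] ∧′ [ c ]) ∧′ ¬′ (joins bs ∨′ joins ds)
      ≈⟨ E.∧-congˡ (E.deMorgan₂ _ _) ⟩
    ([ a ] ∧′ [ c ]) ∧′ (¬′ joins bs ∧′ ¬′ joins ds)
      ≈⟨ interchange [ a ] [ c ] _ _ ⟩
    clause (a , bs) ∧′ clause (c , ds) ∎
    where
    open CommutativeSemigroupProperties (Sublattice.∧-commutativeSemigroup (exp B))

  ⋁ᶜ-map-· : ∀ C ds → ⋁ᶜ (map (C ·_) ds) ∼ clause C ∧′ ⋁ᶜ ds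
  ⋁ᶜ-map-· C [] = ∼-sym (E.∧-zeroʳ _)
  ⋁ᶜ-map-· C (D ∷ ds) = ∼-trans (∨-cong (clause-· C D) (⋁ᶜ-map-· C ds)) (∼-sym (∧-distribˡ-∨ _ _ _))

  ⋁ᶜ-⊗ : ∀ cs ds → ⋁ᶜ (cs ⊗ ds) ∼ ⋁ᶜ cs ∧′ ⋁ᶜ ds
  ⋁ᶜ-⊗ [] ds = ∼-sym (E.∧-zeroˡ _)
  ⋁ᶜ-⊗ (C ∷ cs) ds = begin
    ⋁ᶜ (map (C ·_) ds ++ cs ⊗ ds)                  ≈⟨ ⋁ᶜ-++ (map (C ·_) ds) (cs ⊗ ds) ⟩
    ⋁ᶜ (map (C ·_) ds) ∨′ ⋁ᶜ (cs ⊗ ds)             ≈⟨ ∨-cong (⋁ᶜ-map-· C ds) (⋁ᶜ-⊗ cs ds) ⟩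
    (clause C ∧′ ⋁ᶜ ds) ∨′ (⋁ᶜ cs ∧′ ⋁ᶜ ds)        ≈⟨ ∧-distribʳ-∨ _ _ _ ⟨
    (clause C ∨′ ⋁ᶜ cs) ∧′ ⋁ᶜ ds                   ∎

  clause-⊤ : ⋁ᶜ ((B.𝟙 , []) ∷ []) ∼ ⊤′
  clause-⊤ = begin
    ([ B.𝟙 ] ∧′ ¬′ ⊥′) ∨′ ⊥′   ≈⟨ E.∨-identityʳ _ ⟩
    [ B.𝟙 ] ∧′ ¬′ ⊥′           ≈⟨ ∧-cong gen-⊤ E.∁𝟘≈𝟙 ⟩
    ⊤′ ∧′ ⊤′                   ≈⟨ E.∧-identityʳ _ ⟩
    ⊤′                         ∎

  dnf-correct : ∀ s t → ⋁ᶜ (dnf s t) ∼ signed s t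
  dnf-correct true [ a ] = begin
    ([ a ] ∧′ ¬′ ⊥′) ∨′ ⊥′     ≈⟨ E.∨-identityʳ _ ⟩
    [ a ] ∧′ ¬′ ⊥′             ≈⟨ E.∧-congˡ E.∁𝟘≈𝟙 ⟩
    [ a ] ∧′ ⊤′                ≈⟨ E.∧-identityʳ _ ⟩
    [ a ]                      ∎
  dnf-correct false [ a ] = begin
    ([ B.𝟙 ] ∧′ ¬′ ([ a ] ∨′ ⊥′)) ∨′ ⊥′   ≈⟨ E.∨-identityʳ _ ⟩
    [ B.𝟙 ] ∧′ ¬′ ([ a ] ∨′ ⊥′)           ≈⟨ ∧-cong gen-⊤ (¬-cong (E.∨-identityʳ _)) ⟩
    ⊤′ ∧′ ¬′ [ a ]                        ≈⟨ E.∧-identityˡ _ ⟩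
    ¬′ [ a ]                              ∎
  dnf-correct true (t ∨′ u) =
    ∼-trans (⋁ᶜ-++ (dnf true t) _) (∨-cong (dnf-correct true t) (dnf-correct true u))
  dnf-correct false (t ∨′ u) = ∼-trans (⋁ᶜ-⊗ (dnf false t) _)
    (∼-trans (∧-cong (dnf-correct false t) (dnf-correct false u)) (∼-sym (E.deMorgan₂ t u)))
  dnf-correct true (t ∧′ u) =
    ∼-trans (⋁ᶜ-⊗ (dnf true t) _) (∧-cong (dnf-correct true t) (dnf-correct true u))
  dnf-correct false (t ∧′ u) = ∼-trans (⋁ᶜ-++ (dnf false t) _)
    (∼-trans (∨-cong (dnf-correct false t) (dnf-correct false u)) (∼-sym (E.deMorgan₁ t u)))
  dnf-correct true (¬′ t) = dnf-correct false t
  dnf-correct false (¬′ t) = ∼-trans (dnf-correct true t) (∼-sym (E.∁-involutive t))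
  dnf-correct true ⊤′ = clause-⊤
  dnf-correct false ⊤′ = ∼-sym E.∁𝟙≈𝟘
  dnf-correct true ⊥′ = ∼-refl
  dnf-correct false ⊥′ = ∼-trans clause-⊤ (∼-sym E.∁𝟘≈𝟙)

  -- Since [ 0 ] = 0, an extra 0 at the front does not change the join; it is the default when no
  -- member of the list is involved.
  gen-≤-joins : ∀ {b bs} → b ∈ˡ B.𝟘 ∷ bs → [ b ] E.≤ joins bs
  gen-≤-joins (here refl) = E.≤-trans (E.≤-reflexive gen-⊥) (E.𝟘≤ _)
  gen-≤-joins (there b∈bs) = E.≤-⋁ (∈-map⁺ [_] b∈bs)

  clause-≤ : ∀ {a bs r} → a B.≤ r → clause (a , bs) E.≤ [ r ]
  clause-≤ a≤r = E.≤-trans (E.x∧y≤x _ _) (gen-mono a≤r)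

  -- [ r ] ∧ [ c ] lies below [ d ], which the clause excludes.
  ≤-∁clause : ∀ {r c d ds} → d ∈ˡ B.𝟘 ∷ ds → r B.∧ c B.≤ d → [ r ] E.≤ ¬′ clause (c , ds)
  ≤-∁clause d∈ds r∧c≤d = E.disjoint⇒≤∁ (E.≤∁⇒≤𝟘
    (E.≤-trans (E.∧-mono E.≤-refl (E.x∧y≤x _ _)) (E.≤-trans (gen-∧-≤ r∧c≤d) (gen-≤-joins d∈ds)))
    (E.≤-trans (E.x∧y≤y _ _) (E.x∧y≤y _ _)))

  module Separation (ac : AxiomOfChoice ℓ) where

    open Choice ac

    -- The two-valued homomorphism [ a ] ↦ (m ≤ a): the closed set m as a point of the hyperspace.

    module Point {m : B.Carrier} (m≰𝟘 : ¬ m B.≤ B.𝟘) where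

      ev : Term → Bool
      ev [ a ]    = does (em {m B.≤ a})
      ev (t ∨′ u) = ev t Bool.∨ ev u
      ev (t ∧′ u) = ev t Bool.∧ ev u
      ev (¬′ t)   = not (ev t)
      ev ⊤′       = true
      ev ⊥′       = false

      ev-sound : ∀ {t u} → t ∼ u → ev t ≡ ev u
      ev-sound ∼-refl = refl
      ev-sound (∼-sym p) = sym (ev-sound p)
      ev-sound (∼-trans p q) = trans (ev-sound p) (ev-sound q)
      ev-sound (∨-cong p q) = cong₂ Bool._∨_ (ev-sound p) (ev-sound q)
      ev-sound (∧-cong p q) = cong₂ Bool._∧_ (ev-sound p) (ev-sound q)
      ev-sound (¬-cong p) = cong not (ev-sound p)
      ev-sound (∨-comm x y) = Boolₚ.∨-comm (ev x) (ev y)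
      ev-sound (∨-assoc x y z) = Boolₚ.∨-assoc (ev x) (ev y) (ev z)
      ev-sound (∧-comm x y) = Boolₚ.∧-comm (ev x) (ev y)
      ev-sound (∧-assoc x y z) = Boolₚ.∧-assoc (ev x) (ev y) (ev z)
      ev-sound (∨-absorbs-∧ x y) = Boolₚ.∨-abs-∧ (ev x) (ev y)
      ev-sound (∧-absorbs-∨ x y) = Boolₚ.∧-abs-∨ (ev x) (ev y)
      ev-sound (∨-distribˡ-∧ x y z) = Boolₚ.∨-distribˡ-∧ (ev x) (ev y) (ev z)
      ev-sound (∨-distribʳ-∧ x y z) = Boolₚ.∨-distribʳ-∧ (ev x) (ev y) (ev z)
      ev-sound (∧-distribˡ-∨ x y z) = Boolₚ.∧-distribˡ-∨ (ev x) (ev y) (ev z)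
      ev-sound (∧-distribʳ-∨ x y z) = Boolₚ.∧-distribʳ-∨ (ev x) (ev y) (ev z)
      ev-sound (∨-complementˡ x) = Boolₚ.∨-inverseˡ (ev x)
      ev-sound (∨-complementʳ x) = Boolₚ.∨-inverseʳ (ev x)
      ev-sound (∧-complementˡ x) = Boolₚ.∧-inverseˡ (ev x)
      ev-sound (∧-complementʳ x) = Boolₚ.∧-inverseʳ (ev x)
      -- This is where the closed set m has to be nonempty.
      ev-sound gen-⊥ = dec-false em m≰𝟘
      ev-sound gen-⊤ = dec-true em (B.≤𝟙 m)
      ev-sound (gen-mono a≤b) = does-⇔ (mk⇔ (λ p → p , B.≤-trans p a≤b) proj₁) em (em ×-dec em)
      ev-sound (gen-∧ a b) = does-⇔ (mk⇔ (λ (p , q) → B.∧-greatest p q)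
        (λ p → B.≤-trans p (B.x∧y≤x a b) , B.≤-trans p (B.x∧y≤y a b))) (em ×-dec em) em

      -- The disjunction is taken over the truth values [ b ], so m lies below a single b and not
      -- merely below the join of all of them in `B`.
      ev-joins : ∀ bs → ev (joins bs) ≡ true → ∃ λ b → b ∈ˡ bs × m B.≤ b
      ev-joins (b ∷ bs) e with em {m B.≤ b}
      ... | yes m≤b = b , here refl , m≤b
      ... | no _ = let b , b∈bs , m≤b = ev-joins bs e in b , there b∈bs , m≤b

    -- The point a ∧ c satisfies [ a ] and [ c ], so disjointness forces it to satisfy some excluded
    -- generator, from one list or the other. The element from the remaining list defaults to 0,
    -- which gives all cases one shape.
    separate : ∀ {a bs c ds} → clause (a , bs) ∧′ clause (c , ds) E.≤ ⊥′ →
      ∃₂ λ b d → b ∈ˡ B.𝟘 ∷ bs × d ∈ˡ B.𝟘 ∷ ds × (b ≡ B.𝟘 ⊎ d ≡ B.𝟘) ×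
        a B.∧ c B.≤ b B.∨ d
    separate {a} {bs} {c} {ds} disjoint with em {a B.∧ c B.≤ B.𝟘}
    -- The empty set is not a point of the hyperspace, so this case is treated without evaluation.
    ... | yes m≤𝟘 = B.𝟘 , B.𝟘 , here refl , here refl , inj₁ refl , B.≤-trans m≤𝟘 (B.𝟘≤ _)
    ... | no m≰𝟘 = decide (ev (joins bs)) (ev (joins ds)) refl refl
      where
      open Point m≰𝟘
      decide : ∀ j j′ → ev (joins bs) ≡ j → ev (joins ds) ≡ j′ → _
      decide true _ e _ = let b , b∈bs , m≤b = ev-joins bs e in
        b , B.𝟘 , there b∈bs , here refl , inj₂ refl , B.≤-trans m≤b (B.x≤x∨y _ _)
      decide false true _ e = let d , d∈ds , m≤d = ev-joins ds e in
        B.𝟘 , d , here refl , there d∈ds , inj₁ refl , B.≤-trans m≤d (B.y≤x∨y _ _)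
      decide false false e e′ = contradiction (trans (sym value)
          (trans (ev-sound disjoint) (Boolₚ.∧-zeroʳ _))) λ ()
        where
        value : ev (clause (a , bs) ∧′ clause (c , ds)) ≡ true
        value rewrite e | e′ | dec-true (em {a B.∧ c B.≤ a}) (B.x∧y≤x a c)
                    | dec-true (em {a B.∧ c B.≤ c}) (B.x∧y≤y a c) = refl

    separate-≤ : ∀ {a b c d} → a B.∧ c B.≤ b B.∨ d → a B.∧ B.∁ b B.≤ B.∁ c B.∨ d
    separate-≤ p = B.shift (B.resolve
      (B.≤-trans (B.∧-mono (B.x∧y≤x _ _) B.≤-refl) p)
      (B.≤-trans (B.x∧y≤x _ _) (B.x∧y≤y _ _)))

  -- Supports and interpolation between terms

  lefts rights : Clause → List B.Carrier
  lefts  (a , bs) = map (λ b → a B.∧ B.∁ b) (B.𝟘 ∷ bs)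
  rights (c , ds) = map (λ d → B.∁ c B.∨ d) (B.𝟘 ∷ ds)

  -- A term occurs on both sides of inequalities: as the smaller one it contributes left sides from
  -- its own clauses, as the larger one right sides from the clauses of its complement.
  support : Term → List B.Carrier
  support t = concatMap lefts (dnf true t) ++ concatMap rights (dnf false t)

  lefts⊆support : ∀ {t C e} → C ∈ˡ dnf true t → e ∈ˡ lefts C → e ∈ˡ support t
  lefts⊆support {t} C∈ e∈ = ∈-++⁺ˡ (∈-concatMap⁺ lefts (Any.map (λ { refl → e∈ }) C∈))

  rights⊆support : ∀ {t D e} → D ∈ˡ dnf false t → e ∈ˡ rights D → e ∈ˡ support t
  rights⊆support {t} D∈ e∈ = ∈-++⁺ʳ (concatMap lefts (dnf true t))
    (∈-concatMap⁺ rights (Any.map (λ { refl → e∈ }) D∈))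

  -- In the Vietoris hyperspace these are the closed sets contained in r and the closed sets that
  -- meet r.
  box diamond : Func B.setoid E.setoid
  box = record
    { to = [_]
    ; cong = λ p → Poset.antisym (posetOf (exp B))
        (gen-mono (B.≤-reflexive p)) (gen-mono (B.≤-reflexive (B.≈-sym p)))
    }
  diamond = record { to = λ r → ¬′ [ B.∁ r ] ; cong = λ p → ¬-cong (Func.cong box (B.¬-cong p)) }

  Contains : (B.Carrier → Pred B.Carrier ℓ) → Term → Pred Term ℓ → Set ℓ
  Contains F t G = ∀ {e r} → e ∈ˡ support t → r ∈ F e → [ r ] ∈ G × ¬′ [ B.∁ r ] ∈ G

  module Hull (ac : AxiomOfChoice ℓ) {Λ : Cardinal ℓ} (ω≤Λ : Infinite Λ)
    (F : B.Carrier → SmallSubset B.setoid Λ) where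

    open SmallSubsets ac ω≤Λ
    open SmallSublattice ac ω≤Λ (exp B)

    -- Which of the two images is used depends on the other term, so both are included.
    images : B.Carrier → SmallSubset E.setoid Λ
    images e = image box (F e) ∪ image diamond (F e)

    generators : Term → SmallSubset E.setoid Λ
    generators t = ⋃ images (support t)

    hull : Term → SmallSubset E.setoid Λ
    hull t = generated (generators t)

    generators-contain : ∀ t → Contains (λ e → elements (F e)) t (elements (generators t))
    generators-contain t e∈ r∈ =
      ∈-⋃ {S = E.setoid} {F = images} e∈ (inj₁ (_ , r∈ , ∼-refl)) ,
      ∈-⋃ {S = E.setoid} {F = images} e∈ (inj₂ (_ , r∈ , ∼-refl))

  module Interpolate (ac : AxiomOfChoice ℓ) (F G : B.Carrier → Pred B.Carrier ℓ)
    (interpolate : ∀ {p q} → p B.≤ q → ∃ λ r → r ∈ F p ∩ G q × p B.≤ r × r B.≤ q)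
    {t u : Term} (X Y : Pred Term ℓ) (X∋ : Contains F t X) (Y∋ : Contains G u Y) where

    open Separation ac
    open Sublattice (exp B) using (isGenerator)
    open Interpolation (exp B)

    between-clauses : ∀ {C D} → C ∈ˡ dnf true t → D ∈ˡ dnf false u → clause C ∧′ clause D E.≤ ⊥′ →
      Between {X} {Y} (clause C) (¬′ clause D)
    between-clauses {a , bs} {c , ds} C∈ D∈ disjoint
      with separate disjoint
    ... | b , d , b∈ , d∈ , b≡𝟘⊎d≡𝟘 , a∧c≤b∨d
      with interpolate (separate-≤ a∧c≤b∨d)
    ... | r , (r∈F , r∈G) , a∧∁b≤r , r≤∁c∨d = choose b≡𝟘⊎d≡𝟘
      where
      inX = X∋ (lefts⊆support {t} C∈ (∈-map⁺ (λ b → a B.∧ B.∁ b) b∈)) r∈F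
      inY = Y∋ (rights⊆support {u} D∈ (∈-map⁺ (λ d → B.∁ c B.∨ d) d∈)) r∈G
      choose : b ≡ B.𝟘 ⊎ d ≡ B.𝟘 → Between {X} {Y} (clause (a , bs)) (¬′ clause (c , ds))
      -- With b = 0, r lies above a, and r ∧ c ≤ d makes [ r ] disjoint from the second clause.
      choose (inj₁ refl) = [ r ] ,
        (isGenerator (proj₁ inX) , isGenerator (proj₁ inY)) ,
        clause-≤ {bs = bs} (B.≤-trans a≤a∧∁𝟘 a∧∁b≤r) ,
        ≤-∁clause d∈ (B.unshift r≤∁c∨d)
        where
        a≤a∧∁𝟘 : a B.≤ a B.∧ B.∁ B.𝟘
        a≤a∧∁𝟘 = B.∧-greatest B.≤-refl
          (B.≤-trans (B.≤𝟙 a) (B.≤-reflexive (B.≈-sym B.∁𝟘≈𝟙)))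
      -- With d = 0, c ≤ ¬ r puts the second clause below [ ¬ r ], and a ∧ ¬ r ≤ b makes [ ¬ r ]
      -- disjoint from the first.
      choose (inj₂ refl) = ¬′ [ B.∁ r ] ,
        (isGenerator (proj₂ inX) , isGenerator (proj₂ inY)) ,
        E.≤∁-sym (≤-∁clause b∈ (B.≤-trans (B.≤-reflexive (B.∧-comm _ _)) (B.exchange a∧∁b≤r))) ,
        E.∁-anti (clause-≤ {bs = ds} (B.≤∁-sym (B.disjoint⇒≤∁ (B.unshift r≤∁c∨d))))

    between : t E.≤ u → Between {X} {Y} t u
    between t≤u
      with between-⋁ (map clause (dnf true t)) (map clause (dnf false u)) pairs
      where
      pairs : ∀ {x y} → x ∈ˡ map clause (dnf true t) → y ∈ˡ map clause (dnf false u) →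
        Between {X} {Y} x (¬′ y)
      pairs x∈ y∈ with ∈-map⁻ clause x∈ | ∈-map⁻ clause y∈
      ... | C , C∈ , refl | D , D∈ , refl = between-clauses C∈ D∈ (E.≤∁⇒disjoint (E.≤-trans
        (E.≤-trans (E.≤-⋁ x∈) (E.≤-trans (E.≤-reflexive (dnf-correct true t)) t≤u))
        (E.≤∁-sym (E.≤-trans (E.≤-⋁ y∈) (E.≤-reflexive (dnf-correct false u))))))
    ... | z , z∈ , t≤z , z≤u = z , z∈ ,
      E.≤-trans (E.≤-reflexive (∼-sym (dnf-correct true t))) t≤z ,
      E.≤-trans z≤u (E.≤-reflexive (∼-trans (¬-cong (dnf-correct false u)) (E.∁-involutive u)))

-- Transfer of the Freese-Nation property

module Exp-FN (ac : AxiomOfChoice ℓ) {Λ κ : Cardinal ℓ} (ω≤Λ : Infinite Λ) (ω≤κ : Infinite κ)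
  (B : BooleanAlgebra ℓ ℓ) (fn : FN Λ κ (posetOf B)) where

  open FN fn
  open Exponential B using (Term; _∼_; ∼-refl; ∼-sym)
  open Clauses B
  private module E = BooleanOrder (exp B)

  -- Supports depend on the term and not only on its class. A section into terms with propositional
  -- equality turns any function of terms into one that respects `_∼_`.
  quotient : Surjection (setoid Term) E.setoid
  quotient = record
    { to = id
    ; cong = λ { refl → ∼-refl }
    ; surjective = λ t → t , λ { refl → ∼-refl }
    }

  representative : Func E.setoid (setoid Term)
  representative = proj₁ (ac quotient)

  rep : Term → Term
  rep = representative ⟨$⟩_

  rep-∼ : ∀ t → rep t ∼ t
  rep-∼ = proj₂ (ac quotient)

  on-representatives : {μ : Cardinal ℓ} → (Term → SmallSubset E.setoid μ) →
    Func E.setoid ([ E.setoid ]^< μ)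
  on-representatives H = record
    { to = λ t → H (rep t)
    ; cong = λ t∼u → ≡⇒≐ (Func.cong representative t∼u)
    }
    where
    ≡⇒≐ : ∀ {t u} → t ≡ u → elements (H t) ≐ elements (H u)
    ≡⇒≐ refl = id , id

  rep-≤ : ∀ {t u} → t E.≤ u → rep t E.≤ rep u
  rep-≤ t≤u = E.≤-trans (E.≤-reflexive (rep-∼ _)) (E.≤-trans t≤u (E.≤-reflexive (∼-sym (rep-∼ _))))

  unrep-≤ : ∀ {t z u} → rep t E.≤ z × z E.≤ rep u → t E.≤ z × z E.≤ u
  unrep-≤ (p , q) = E.≤-trans (E.≤-reflexive (∼-sym (rep-∼ _))) p , E.≤-trans q (E.≤-reflexive (rep-∼ _))

  exp-FN : FN Λ κ (posetOf (exp B))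
  exp-FN = record
    { f = on-representatives (HF.hull)
    ; g = on-representatives (HG.hull)
    ; interpolate-fg = λ {p} {q} p≤q →
        let z , z∈ , p≤z≤q = FG.between (rep p) (rep q) (rep-≤ p≤q)
        in z , z∈ , unrep-≤ {p} {z} {q} p≤z≤q
    ; interpolate-gf = λ {p} {q} p≤q →
        let z , z∈ , p≤z≤q = GF.between (rep p) (rep q) (rep-≤ p≤q)
        in z , z∈ , unrep-≤ {p} {z} {q} p≤z≤q
    }
    where
    module HF = Hull ac ω≤Λ (f ⟨$⟩_)
    module HG = Hull ac ω≤κ (g ⟨$⟩_)
    module FG t u = Interpolate ac (λ e → elements (f ⟨$⟩ e)) (λ e → elements (g ⟨$⟩ e))
      interpolate-fg {t} {u} (elements (HF.generators t)) (elements (HG.generators u))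
      (HF.generators-contain t) (HG.generators-contain u)
    module GF t u = Interpolate ac (λ e → elements (g ⟨$⟩ e)) (λ e → elements (f ⟨$⟩ e))
      interpolate-gf {t} {u} (elements (HG.generators t)) (elements (HF.generators u))
      (HG.generators-contain t) (HF.generators-contain u)

theorem2p9 : {ℓ : Level} → AxiomOfChoice ℓ →
    (Λ κ : Cardinal ℓ) → Infinite Λ → Infinite κ → κ ≤ᶜ Λ →
    (B : BooleanAlgebra ℓ ℓ) →
    FN Λ κ (posetOf B) → FN Λ κ (posetOf (exp B))
theorem2p9 ac Λ κ ω≤Λ ω≤κ _ B fn = Exp-FN.exp-FN ac ω≤Λ ω≤κ B fn
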